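{- For every integer $k\geq 1$, $$GR_k(K_{4}+e)=\begin{cases} 17^{k/2}+1, & \text{if $k$ is even},\\ 4\cdot 17^{(k-1)/2}+1, & \text{if $k$ is odd}.\end{cases}$$
   Context: $K_4+e$ denotes the graph on five vertices consisting of a $K_4$ together with a pendant edge (an extra vertex joined to exactly one vertex of the $K_4$). A $k$-edge-coloring of a graph is a map from its edge set to $[k]$. A Gallai-$k$-coloring is a $k$-edge-coloring of a complete graph containing no rainbow triangle (triangle with three distinct colors). $GR_k(H)$ is the minimum integer $N$ such that every Gallai-$k$-coloring of $K_N$ contains a monochromatic copy of $H$. -}

module Defs where

open import Data.Nat using (ℕ; zero; suc; _+_; _*_; _^_; _<_)
open import Data.Fin using (Fin; zero; suc)
open import Data.Product using (Σ; _×_; _,_; ∃)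
open import Relation.Binary.PropositionalEquality using (_≡_; _≢_)
open import Relation.Nullary using (¬_)
open import Function.Definitions using (Injective)

-- A k-edge-coloring of the complete graph K_N on vertex set Fin N:
-- a symmetric map on pairs of vertices; only values on pairs u ≢ v
-- (the edges) matter, diagonal values are ignored everywhere.
record EdgeColoring (N k : ℕ) : Set where
  field
    col  : Fin N → Fin N → Fin k
    symm : ∀ u v → col u v ≡ col v u
open EdgeColoring public

RainbowTriangle : ∀ {N k} → EdgeColoring N k → Set
RainbowTriangle {N} c =
  Σ (Fin N) λ x → Σ (Fin N) λ y → Σ (Fin N) λ z →
    x ≢ y × y ≢ z × x ≢ z ×
    col c x y ≢ col c y z × col c y z ≢ col c x z × col c x y ≢ col c x z

Gallai : ∀ {N k} → EdgeColoring N k → Set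
Gallai c = ¬ RainbowTriangle c

-- K4+e: K4 on vertices 0,1,2,3 plus pendant edge {0,4}.
-- A monochromatic copy: an injective vertex map f : Fin 5 → Fin N and a colour a
-- such that all 7 edges of K4+e are mapped to edges of colour a.
MonoK4e : ∀ {N k} → EdgeColoring N k → Set
MonoK4e {N} {k} c =
  Σ (Fin 5 → Fin N) λ f → Σ (Fin k) λ a →
    Injective _≡_ _≡_ f ×
    (col c (f v0) (f v1) ≡ a) × (col c (f v0) (f v2) ≡ a) × (col c (f v0) (f v3) ≡ a) ×
    (col c (f v1) (f v2) ≡ a) × (col c (f v1) (f v3) ≡ a) × (col c (f v2) (f v3) ≡ a) ×
    (col c (f v0) (f v4) ≡ a)
  where
    v0 v1 v2 v3 v4 : Fin 5
    v0 = zero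
    v1 = suc zero
    v2 = suc (suc zero)
    v3 = suc (suc (suc zero))
    v4 = suc (suc (suc (suc zero)))

Arrows : ℕ → ℕ → Set
Arrows k N = (c : EdgeColoring N k) → Gallai c → MonoK4e c

IsGR-K4e : ℕ → ℕ → Set
IsGR-K4e k N = Arrows k N × (∀ M → M < N → ¬ Arrows k M)

{-# OPTIONS --safe #-}

-- Lower bound: blow up the Paley graph on 17 vertices, which is K₄-free in both colours, once for
-- every two colours; an odd colour is spent on monochromatic K₄'s at the innermost level.
--
-- Upper bound: give every colour class one of three states (no edge, K₃-free, (K₄ + e)-free) and
-- show by induction on the states that a Gallai colouring has at most g(#(K₄ + e)-free) h(#K₃-free)
-- vertices, where g = 1, 4, 17, 4·17, 17², … and h = 1, 2, 5, 2·5, 5², …. By Gallai's theorem the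
-- vertices split into parts with a reduced colouring in two colours. If some cut is monochromatic,
-- its colour is weakened on both sides. Otherwise both reduced colours are connected, which turns
-- (K₄ + e)-free into K₄-free, since a monochromatic K₄ would be a whole component; and every part
-- sees both colours. If no part contains an edge of a reduced colour then R(3,3) = 6, R(3,4) = 9,
-- R(4,4) = 18 bound the number of parts. If some part does, then that part, its neighbourhood in
-- the first colour and its neighbourhood in the second have weakened states, and the induction
-- hypothesis bounds each of them.

module Submission where

open import Defs
open import Data.Bool using (if_then_else_)
open import Data.Empty using (⊥; ⊥-elim)
open import Data.Fin using (Fin; zero; suc; toℕ; quotient; remainder; combine; inject≤; splitAt; _↑ˡ_; _↑ʳ_)
open import Data.Fin.Properties using
  (_≟_; any?; all?; ↑ˡ-injective; ↑ʳ-injective; inject≤-injective; injective⇒≤; combine-remQuot;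
   splitAt-↑ˡ; splitAt-↑ʳ; splitAt⁻¹-↑ˡ; splitAt⁻¹-↑ʳ)
open import Data.Nat hiding (_≟_)
import Data.Nat as ℕ
open import Data.Nat.DivMod using (_%_; _divMod_; result)
open import Data.Nat.Properties hiding (_≟_)
open import Data.Nat.Solver using (module +-*-Solver)
open import Data.Product using (Σ; _×_; _,_; ∃; proj₁; proj₂; map₂) renaming (swap to ×-swap)
open import Data.Sum using (_⊎_; inj₁; inj₂; [_,_]; swap)
open import Data.Unit using (⊤)
open import Data.Vec using (lookup; []; _∷_)
open import Data.Vec.Functional using (updateAt)
open import Data.Vec.Functional.Properties using (updateAt-updates; updateAt-minimal)
open import Data.Vec.Relation.Unary.All using ([]; _∷_)
open import Data.Vec.Relation.Unary.AllPairs using ([]; _∷_)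
open import Data.Vec.Relation.Unary.Unique.Propositional.Properties using (lookup-injective)
open import Function using (_∘_; case_of_; const; id; flip)
open import Relation.Binary.PropositionalEquality hiding ([_])
open import Relation.Nullary
open import Relation.Nullary.Decidable using (dec-true; dec-false; from-yes; from-no)

open import Algebra.Properties.Semiring.Sum +-*-semiring
  using (sum; sum-cong-≗; ∑-distrib-+; ∑-comm; sum-replicate-zero; *-distribʳ-sum)

-- Counting

sum-mono : ∀ {n} {f g : Fin n → ℕ} → (∀ i → f i ≤ g i) → sum f ≤ sum g
sum-mono {zero}  f≤g = z≤n
sum-mono {suc n} f≤g = +-mono-≤ (f≤g zero) (sum-mono (f≤g ∘ suc))

term≤sum : ∀ {n} (f : Fin n → ℕ) i → f i ≤ sum f
term≤sum f zero    = m≤m+n _ _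
term≤sum f (suc i) = ≤-trans (term≤sum (f ∘ suc) i) (m≤n+m _ _)

-- Deleting vertex `zero` removes one row and one column, which agree by symmetry and meet in a
-- zero, so the total drops by twice a row sum.
handshake : ∀ {n} (e : Fin n → Fin n → ℕ) → (∀ x y → e x y ≡ e y x) → (∀ x → e x x ≡ 0) →
            ∃ λ t → sum (λ x → sum (e x)) ≡ t + t
handshake {zero}  e symmetric irreflexive = 0 , refl
handshake {suc n} e symmetric irreflexive
  with t , eq ← handshake (λ x y → e (suc x) (suc y)) (λ x y → symmetric (suc x) (suc y)) (irreflexive ∘ suc)
  = row + t , (begin
      (e zero zero + row) + sum (λ x → e (suc x) zero + sum (λ y → e (suc x) (suc y)))
        ≡⟨ cong₂ _+_ (cong (_+ row) (irreflexive zero)) (∑-distrib-+ {n} _ _) ⟩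
      row + (sum (λ x → e (suc x) zero) + sum (λ x → sum (λ y → e (suc x) (suc y))))
        ≡⟨ cong₂ (λ p q → row + (p + q)) (sum-cong-≗ (λ x → symmetric (suc x) zero)) eq ⟩
      row + (row + (t + t))
        ≡⟨ solve 2 (λ r t → r :+ (r :+ (t :+ t)) := (r :+ t) :+ (r :+ t)) refl row t ⟩
      (row + t) + (row + t) ∎)
  where
  open ≡-Reasoning
  open +-*-Solver
  row = sum (λ y → e zero (suc y))

indicator : ∀ {P : Set} → Dec P → ℕ
indicator d = if does d then 1 else 0

indicator-yes : ∀ {P : Set} (d : Dec P) → P → indicator d ≡ 1
indicator-yes d p rewrite dec-true d p = refl

indicator-no : ∀ {P : Set} (d : Dec P) → ¬ P → indicator d ≡ 0
indicator-no d ¬p rewrite dec-false d ¬p = refl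

indicator-cong : ∀ {P Q : Set} (d : Dec P) (e : Dec Q) → (P → Q) → (Q → P) → indicator d ≡ indicator e
indicator-cong (yes p) e to from = sym (indicator-yes e (to p))
indicator-cong (no ¬p) e to from = sym (indicator-no e (¬p ∘ from))

-- Decidable subsets and their cardinalities

record Subset (n : ℕ) : Set₁ where
  field
    Mem : Fin n → Set
    mem? : ∀ x → Dec (Mem x)
open Subset public

infix 4 _∈_ _∉_ _∈?_ _⊆_

_∈_ _∉_ : ∀ {n} → Fin n → Subset n → Set
x ∈ S = Mem S x
x ∉ S = ¬ x ∈ S

_∈?_ : ∀ {n} (x : Fin n) (S : Subset n) → Dec (x ∈ S)
x ∈? S = mem? S x

_⊆_ : ∀ {n} → Subset n → Subset n → Set
S ⊆ T = ∀ x → x ∈ S → x ∈ T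

infixr 6 _∪_ _∩_

_∪_ : ∀ {n} → Subset n → Subset n → Subset n
(S ∪ T) .Mem x = x ∈ S ⊎ x ∈ T
(S ∪ T) .mem? x = x ∈? S ⊎-dec x ∈? T

_∩_ : ∀ {n} → Subset n → Subset n → Subset n
(S ∩ T) .Mem x = x ∈ S × x ∈ T
(S ∩ T) .mem? x = x ∈? S ×-dec x ∈? T

∁ : ∀ {n} → Subset n → Subset n
∁ S .Mem x = x ∉ S
∁ S .mem? x = ¬? (x ∈? S)

card : ∀ {n} → Subset n → ℕ
card S = sum (λ x → indicator (x ∈? S))

full : ∀ n → Subset n
full n .Mem _ = ⊤
full n .mem? _ = yes _

card-full : ∀ n → card (full n) ≡ n
card-full zero    = refl
card-full (suc n) = cong suc (card-full n)

⁅_⁆ : ∀ {n} → Fin n → Subset n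
⁅ x ⁆ .Mem y = x ≡ y
⁅ x ⁆ .mem? y = x ≟ y

card-⁅⁆ : ∀ {n} (x : Fin n) → card ⁅ x ⁆ ≡ 1
card-⁅⁆ {suc n} zero    = cong suc (sum-replicate-zero n)
card-⁅⁆         (suc x) = card-⁅⁆ x

module _ {n : ℕ} where

  card-cover : (S A B : Subset n) → (∀ x → x ∈ S → x ∈ A ⊎ x ∈ B) → card S ≤ card A + card B
  card-cover S A B covers = ≤-trans (sum-mono pointwise) (≤-reflexive (∑-distrib-+ {n} _ _))
    where
    pointwise : ∀ x → indicator (x ∈? S) ≤ indicator (x ∈? A) + indicator (x ∈? B)
    pointwise x with x ∈? S
    ... | no  _   = z≤n
    ... | yes x∈S with covers x x∈S
    ...   | inj₁ x∈A rewrite indicator-yes (x ∈? A) x∈A = s≤s z≤n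
    ...   | inj₂ x∈B rewrite indicator-yes (x ∈? B) x∈B = m≤n+m 1 _

  card-cover₃ : (S A B C : Subset n) → (∀ x → x ∈ S → x ∈ A ⊎ x ∈ B ⊎ x ∈ C) →
                card S ≤ card A + (card B + card C)
  card-cover₃ S A B C covers =
    ≤-trans (card-cover S A (B ∪ C) covers) (+-monoʳ-≤ (card A) (card-cover (B ∪ C) B C (λ _ → id)))

  card-empty : (S : Subset n) → (∀ x → x ∉ S) → card S ≡ 0
  card-empty S empty =
    trans (sum-cong-≗ (λ x → indicator-no (x ∈? S) (empty x))) (sum-replicate-zero n)

  card-⊆ : (S T : Subset n) → S ⊆ T → card S ≤ card T
  card-⊆ S T S⊆T = sum-mono pointwise
    where
    pointwise : ∀ x → indicator (x ∈? S) ≤ indicator (x ∈? T)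
    pointwise x with x ∈? S
    ... | no  _   = z≤n
    ... | yes x∈S = ≤-reflexive (sym (indicator-yes (x ∈? T) (S⊆T x x∈S)))

  card-⊂ : (S T : Subset n) → S ⊆ T → ∀ z → z ∈ T → z ∉ S → card S < card T
  card-⊂ S T S⊆T z z∈T z∉S = begin
    1 + card S         ≡⟨ cong (_+ card S) (sym (card-⁅⁆ z)) ⟩
    card ⁅ z ⁆ + card S ≡⟨ sym (∑-distrib-+ {n} _ _) ⟩
    sum (λ x → indicator (x ∈? ⁅ z ⁆) + indicator (x ∈? S)) ≤⟨ sum-mono pointwise ⟩
    card T             ∎
    where
    open ≤-Reasoning
    pointwise : ∀ x → indicator (x ∈? ⁅ z ⁆) + indicator (x ∈? S) ≤ indicator (x ∈? T)
    pointwise x with z ≟ x | x ∈? S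
    ... | yes refl | yes z∈S = contradiction z∈S z∉S
    ... | yes refl | no  _   = ≤-reflexive (sym (indicator-yes (z ∈? T) z∈T))
    ... | no  _    | yes x∈S = ≤-reflexive (sym (indicator-yes (x ∈? T) (S⊆T x x∈S)))
    ... | no  _    | no  _   = z≤n

  card-∈ : (S : Subset n) → ∀ x → x ∈ S → 1 ≤ card S
  card-∈ S x x∈S = subst (_≤ card S) (indicator-yes (x ∈? S) x∈S) (term≤sum _ x)

  inhabited : (S : Subset n) → 1 ≤ card S → ∃ (_∈ S)
  inhabited S 1≤S with any? (_∈? S)
  ... | yes x∈S = x∈S
  ... | no  ∄   = contradiction (subst (1 ≤_) (card-empty S (λ x x∈S → ∄ (x , x∈S))) 1≤S) λ ()

  fibre : (V : Subset n) → (Fin n → Fin n) → Fin n → Subset n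
  fibre V f y .Mem x = x ∈ V × f x ≡ y
  fibre V f y .mem? x = x ∈? V ×-dec f x ≟ y

  -- Double counting: every `x` of `V` is counted in the fibre over `f x`, and fibres over points
  -- outside `R` are empty.
  card-fibres : (V R : Subset n) (f : Fin n → Fin n) → (∀ x → x ∈ V → f x ∈ R) →
                ∀ m → (∀ y → y ∈ R → card (fibre V f y) ≤ m) → card V ≤ card R * m
  card-fibres V R f f∈R m small = begin
    card V                                              ≤⟨ sum-mono covered ⟩
    sum (λ x → sum (λ y → indicator (x ∈? fibre V f y))) ≡⟨ ∑-comm {n} {n} _ ⟩
    sum (λ y → card (fibre V f y))                      ≤⟨ sum-mono fibre≤ ⟩
    sum (λ y → indicator (y ∈? R) * m)                  ≡⟨ sym (*-distribʳ-sum m (λ y → indicator (y ∈? R))) ⟩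
    card R * m                                          ∎
    where
    open ≤-Reasoning
    covered : ∀ x → indicator (x ∈? V) ≤ sum (λ y → indicator (x ∈? fibre V f y))
    covered x with x ∈? V
    ... | no  _   = z≤n
    ... | yes x∈V = ≤-trans (≤-reflexive (sym (indicator-yes (f x ≟ f x) refl))) (term≤sum (λ y → indicator (f x ≟ y)) (f x))
    fibre≤ : ∀ y → card (fibre V f y) ≤ indicator (y ∈? R) * m
    fibre≤ y with y ∈? R
    ... | yes y∈R = subst (card (fibre V f y) ≤_) (sym (+-identityʳ m)) (small y y∈R)
    ... | no  y∉R = ≤-reflexive (card-empty (fibre V f y) λ { x (x∈V , refl) → y∉R (f∈R x x∈V) })

-- Cliques and Ramsey bounds

module Cliques {N k : ℕ} (c : EdgeColoring N k) where

  Adj : Fin k → Fin N → Fin N → Set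
  Adj a x y = x ≢ y × col c x y ≡ a

  adj? : ∀ a x y → Dec (Adj a x y)
  adj? a x y = ¬? (x ≟ y) ×-dec col c x y ≟ a

  adj-sym : ∀ {a x y} → Adj a x y → Adj a y x
  adj-sym (x≢y , xy) = x≢y ∘ sym , trans (symm c _ _) xy

  nbhd : Fin k → Subset N → Fin N → Subset N
  nbhd a S x .Mem y = y ∈ S × Adj a x y
  nbhd a S x .mem? y = y ∈? S ×-dec adj? a x y

  -- Free a r S: every clique of colour a inside S has at most r vertices.
  Free : Fin k → ℕ → Subset N → Set
  Free a zero    S = ∀ x → x ∉ S
  Free a (suc r) S = ∀ x → x ∈ S → Free a r (nbhd a S x)

  nbhd-⊆ : ∀ a S T x → S ⊆ T → nbhd a S x ⊆ nbhd a T x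
  nbhd-⊆ a S T x S⊆T y (y∈S , xy) = S⊆T y y∈S , xy

  Free-⊆ : ∀ {a} r S T → S ⊆ T → Free a r T → Free a r S
  Free-⊆ zero    S T S⊆T free x x∈S = free x (S⊆T x x∈S)
  Free-⊆ {a} (suc r) S T S⊆T free x x∈S =
    Free-⊆ r (nbhd a S x) (nbhd a T x) (nbhd-⊆ a S T x S⊆T) (free x (S⊆T x x∈S))

  Free-suc : ∀ {a} r S → Free a r S → Free a (suc r) S
  Free-suc {a} r S free x _ = Free-⊆ r (nbhd a S x) S (λ _ → proj₁) free

  edge? : ∀ a S → Free a 1 S ⊎ (∃ λ x → ∃ λ y → x ∈ S × y ∈ S × Adj a x y)
  edge? a S with any? (λ x → any? (λ y → x ∈? S ×-dec y ∈? S ×-dec adj? a x y))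
  ... | yes found = inj₂ found
  ... | no  ∄     = inj₁ λ { x x∈S y (y∈S , xy) → ∄ (x , y , x∈S , y∈S , xy) }

  free₁? : ∀ a S → Dec (Free a 1 S)
  free₁? a S with edge? a S
  ... | inj₁ free = yes free
  ... | inj₂ (x , y , x∈S , y∈S , xy) = no λ free → free x x∈S y (y∈S , xy)

  TwoColoured : Fin k → Fin k → Subset N → Set
  TwoColoured a b S = ∀ x y → x ∈ S → y ∈ S → x ≢ y → col c x y ≡ a ⊎ col c x y ≡ b

  module Ramsey {a b : Fin k} where

    TwoColoured-nbhd : ∀ d S x → TwoColoured a b S → TwoColoured a b (nbhd d S x)
    TwoColoured-nbhd d S x two y z (y∈S , _) (z∈S , _) = two y z y∈S z∈S

    neighbours : ∀ S → TwoColoured a b S → ∀ x → x ∈ S →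
                 card S ≤ 1 + (card (nbhd a S x) + card (nbhd b S x))
    neighbours S two x x∈S =
      subst (λ m → card S ≤ m + (card (nbhd a S x) + card (nbhd b S x))) (card-⁅⁆ x)
        (card-cover₃ S ⁅ x ⁆ (nbhd a S x) (nbhd b S x) split)
      where
      split : ∀ y → y ∈ S → x ≡ y ⊎ y ∈ nbhd a S x ⊎ y ∈ nbhd b S x
      split y y∈S with x ≟ y
      ... | yes x≡y = inj₁ x≡y
      ... | no  x≢y with two x y x∈S y∈S x≢y
      ...   | inj₁ xy = inj₂ (inj₁ (y∈S , x≢y , xy))
      ...   | inj₂ xy = inj₂ (inj₂ (y∈S , x≢y , xy))

    -- The usual Ramsey recursion: a vertex and its neighbours in the two colours exhaust `S`.
    ramsey-step : ∀ S → TwoColoured a b S → ∀ p q →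
                  (∀ x → x ∈ S → card (nbhd a S x) ≤ p) → (∀ x → x ∈ S → card (nbhd b S x) ≤ q) →
                  card S ≤ 1 + (p + q)
    ramsey-step S two p q ≤p ≤q with any? (_∈? S)
    ... | yes (x , x∈S) = ≤-trans (neighbours S two x x∈S) (s≤s (+-mono-≤ (≤p x x∈S) (≤q x x∈S)))
    ... | no  ∄         = subst (_≤ 1 + (p + q)) (sym (card-empty S λ x x∈S → ∄ (x , x∈S))) z≤n

    card-Free₀ : ∀ d S → Free d 0 S → card S ≤ 0
    card-Free₀ d S free = ≤-reflexive (card-empty S free)

    ramsey₁ᵇ : ∀ n S → TwoColoured a b S → Free a 1 S → Free b n S → card S ≤ n
    ramsey₁ᵇ zero    S two freeA freeB = card-Free₀ b S freeB
    ramsey₁ᵇ (suc n) S two freeA freeB = ramsey-step S two 0 n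
      (λ x x∈S → card-Free₀ a (nbhd a S x) (freeA x x∈S))
      (λ x x∈S → ramsey₁ᵇ n (nbhd b S x) (TwoColoured-nbhd b S x two)
                   (Free-⊆ 1 (nbhd b S x) S (λ _ → proj₁) freeA) (freeB x x∈S))

    ramsey₁ᵃ : ∀ n S → TwoColoured a b S → Free a n S → Free b 1 S → card S ≤ n
    ramsey₁ᵃ zero    S two freeA freeB = card-Free₀ a S freeA
    ramsey₁ᵃ (suc n) S two freeA freeB = ≤-trans (ramsey-step S two n 0
      (λ x x∈S → ramsey₁ᵃ n (nbhd a S x) (TwoColoured-nbhd a S x two)
                   (freeA x x∈S) (Free-⊆ 1 (nbhd a S x) S (λ _ → proj₁) freeB))
      (λ x x∈S → card-Free₀ b (nbhd b S x) (freeB x x∈S)))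
      (≤-reflexive (cong suc (+-identityʳ n)))

    ramsey₂₂ : ∀ S → TwoColoured a b S → Free a 2 S → Free b 2 S → card S ≤ 5
    ramsey₂₂ S two freeA freeB = ramsey-step S two 2 2
      (λ x x∈S → ramsey₁ᵇ 2 (nbhd a S x) (TwoColoured-nbhd a S x two)
                   (freeA x x∈S) (Free-⊆ 2 (nbhd a S x) S (λ _ → proj₁) freeB))
      (λ x x∈S → ramsey₁ᵃ 2 (nbhd b S x) (TwoColoured-nbhd b S x two)
                   (Free-⊆ 2 (nbhd b S x) S (λ _ → proj₁) freeA) (freeB x x∈S))

    -- The handshake lemma for the graph of colour `a` inside `S`, with incidences extended by zero
    -- to all of `Fin N`.
    degree-sum : ∀ S d → (∀ x → x ∈ S → card (nbhd a S x) ≡ d) → ∃ λ t → card S * d ≡ t + t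
    degree-sum S d regular with handshake incidence incidence-sym incidence-irrefl
      where
      edge : ∀ x y → Dec (x ∈ S × y ∈ S × Adj a x y)
      edge x y = x ∈? S ×-dec y ∈? S ×-dec adj? a x y
      incidence : Fin N → Fin N → ℕ
      incidence x y = indicator (edge x y)
      incidence-sym : ∀ x y → incidence x y ≡ incidence y x
      incidence-sym x y = indicator-cong (edge x y) (edge y x)
        (λ { (x∈S , y∈S , xy) → y∈S , x∈S , adj-sym xy })
        (λ { (y∈S , x∈S , yx) → x∈S , y∈S , adj-sym yx })
      incidence-irrefl : ∀ x → incidence x x ≡ 0
      incidence-irrefl x = indicator-no (edge x x) λ { (_ , _ , x≢x , _) → x≢x refl }
    ... | t , even = t , trans (trans (*-distribʳ-sum d (λ x → indicator (x ∈? S))) (sum-cong-≗ row)) even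
      where
      row : ∀ x → indicator (x ∈? S) * d ≡ sum (λ y → indicator (x ∈? S ×-dec y ∈? S ×-dec adj? a x y))
      row x with x ∈? S
      ... | yes x∈S = trans (+-identityʳ d) (sym (regular x x∈S))
      ... | no  _   = sym (sum-replicate-zero N)

    -- The recursion alone allows 3 + 5 + 1 = 9 vertices. With nine, each vertex has eight
    -- neighbours, at most five of them in colour `b`, so exactly three in colour `a`; the degree
    -- sum 9 · 3 = 27 would then be odd.
    ramsey₂₃ : ∀ S → TwoColoured a b S → Free a 2 S → Free b 3 S → card S ≤ 8
    ramsey₂₃ S two freeA freeB = ≮⇒≥ λ 8<card →
      let card≡9 = ≤-antisym (ramsey-step S two 3 5 ≤3 ≤5) 8<card
          regular : ∀ x → x ∈ S → card (nbhd a S x) ≡ 3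
          regular x x∈S = ≤-antisym (≤3 x x∈S) (+-cancelʳ-≤ 5 3 _ (≤-trans
            (s≤s⁻¹ (≤-trans 8<card (neighbours S two x x∈S))) (+-monoʳ-≤ (card (nbhd a S x)) (≤5 x x∈S))))
          t , even = degree-sum S 3 regular
      in 27-odd t (trans (sym (cong (_* 3) card≡9)) even)
      where
      ≤3 : ∀ x → x ∈ S → card (nbhd a S x) ≤ 3
      ≤3 x x∈S = ramsey₁ᵇ 3 (nbhd a S x) (TwoColoured-nbhd a S x two)
                   (freeA x x∈S) (Free-⊆ 3 (nbhd a S x) S (λ _ → proj₁) freeB)
      ≤5 : ∀ x → x ∈ S → card (nbhd b S x) ≤ 5
      ≤5 x x∈S = ramsey₂₂ (nbhd b S x) (TwoColoured-nbhd b S x two)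
                   (Free-⊆ 2 (nbhd b S x) S (λ _ → proj₁) freeA) (freeB x x∈S)
      27-odd : ∀ t → 27 ≢ t + t
      27-odd t eq with t ≤? 13
      ... | yes t≤13 = <⇒≢ (s≤s (+-mono-≤ t≤13 t≤13)) (sym eq)
      ... | no  t≰13 = <⇒≢ (+-mono-≤ (≰⇒> t≰13) (≰⇒> t≰13)) eq

  open Ramsey using (ramsey₂₂; ramsey₂₃) public

  ramsey₃₃ : ∀ {a b} S → TwoColoured a b S → Free a 3 S → Free b 3 S → card S ≤ 17
  ramsey₃₃ {a} {b} S two freeA freeB = Ramsey.ramsey-step S two 8 8
    (λ x x∈S → ramsey₂₃ (nbhd a S x) (Ramsey.TwoColoured-nbhd a S x two)
                 (freeA x x∈S) (Free-⊆ 3 (nbhd a S x) S (λ _ → proj₁) freeB))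
    (λ x x∈S → ramsey₂₃ (nbhd b S x)
                 (λ y z (y∈S , _) (z∈S , _) y≢z → swap (two y z y∈S z∈S y≢z))
                 (freeB x x∈S) (Free-⊆ 3 (nbhd b S x) S (λ _ → proj₁) freeA))

-- Gallai's decomposition

module Structure {N k : ℕ} (c : EdgeColoring N k) (gallai : Gallai c) where

  open Cliques c

  no-rainbow : ∀ {x y z} → x ≢ y → y ≢ z → x ≢ z →
               col c x y ≢ col c x z → col c y z ≢ col c x y → col c y z ≡ col c x z
  no-rainbow {x} {y} {z} x≢y y≢z x≢z xy≢xz yz≢xy with col c y z ≟ col c x z
  ... | yes yz≡xz = yz≡xz
  ... | no  yz≢xz = ⊥-elim (gallai (x , y , z , x≢y , y≢z , x≢z , yz≢xy ∘ sym , yz≢xz , xy≢xz))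

  Crossing : Fin k → Subset N → Subset N → Set
  Crossing a V D = ∃ λ u → ∃ λ w → u ∈ V × u ∈ D × w ∈ V × w ∉ D × col c u w ≡ a

  Closed : Fin k → Subset N → Subset N → Set
  Closed a V D = ∀ u w → u ∈ V → u ∈ D → w ∈ V → w ∉ D → col c u w ≢ a

  crossing? : ∀ a V D → Crossing a V D ⊎ Closed a V D
  crossing? a V D
    with any? (λ u → any? (λ w →
           u ∈? V ×-dec u ∈? D ×-dec w ∈? V ×-dec ¬? (w ∈? D) ×-dec col c u w ≟ a))
  ... | yes found = inj₁ found
  ... | no  ∄     = inj₂ λ u w u∈V u∈D w∈V w∉D uw → ∄ (u , w , u∈V , u∈D , w∈V , w∉D , uw)

  Connected : Fin k → Subset N → Set₁
  Connected a V = ∀ D d e → d ∈ V → d ∈ D → e ∈ V → e ∉ D → Crossing a V D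

  -- The component of `x` in colour `a` is encoded as the least closed set containing `x` instead of
  -- by paths, so `minimal` serves as the induction principle.
  record Component (a : Fin k) (V : Subset N) (x : Fin N) : Set₁ where
    field
      set     : Subset N
      ⊆V      : set ⊆ V
      root    : x ∈ set
      closed  : Closed a V set
      minimal : ∀ D → x ∈ D → Closed a V D → set ⊆ D

    -- The vertices of the component that `z` sees in the colour of `zx` form a closed set: if `uw`
    -- has colour `a` and `zu`, `zw` differ, then, as neither of these has colour `a`, the triangle
    -- `zuw` is rainbow. By minimality this set is the whole component.
    homogeneous : ∀ {y z} → y ∈ set → z ∈ V → z ∉ set → col c z y ≡ col c z x
    homogeneous {y} {z} y∈ z∈V z∉ = proj₂ (minimal D (root , refl) D-closed y y∈)
      where
      D : Subset N
      D .Mem u = u ∈ set × col c z u ≡ col c z x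
      D .mem? u = u ∈? set ×-dec col c z u ≟ col c z x
      avoids : ∀ {u} → u ∈ set → col c z u ≢ a
      avoids {u} u∈ zu = closed u z (⊆V u u∈) u∈ z∈V z∉ (trans (symm c u z) zu)
      outside : ∀ {u} → u ∈ set → z ≢ u
      outside u∈ refl = z∉ u∈
      D-closed : Closed a V D
      D-closed u w u∈V (u∈ , zu≡zx) w∈V w∉D uw with w ∈? set
      ... | no  w∉ = closed u w u∈V u∈ w∈V w∉ uw
      ... | yes w∈ = avoids w∈ (trans (sym
              (no-rainbow (outside u∈) u≢w (outside w∈) zu≢zw (λ uw≡zu → avoids u∈ (trans (sym uw≡zu) uw)))) uw)
        where
        zu≢zw : col c z u ≢ col c z w
        zu≢zw zu≡zw = w∉D (w∈ , trans (sym zu≡zw) zu≡zx)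
        u≢w : u ≢ w
        u≢w refl = zu≢zw refl

    -- By minimality, whichever of a closed set and its complement contains `x` must contain all of
    -- `V`.
    spanning⇒connected : V ⊆ set → Connected a V
    spanning⇒connected V⊆ D d e d∈V d∈D e∈V e∉D with crossing? a V D
    ... | inj₁ crossing = crossing
    ... | inj₂ D-closed with x ∈? D
    ...   | yes x∈D = contradiction (minimal D x∈D D-closed e (V⊆ e e∈V)) e∉D
    ...   | no  x∉D = contradiction d∈D (minimal (∁ D) x∉D ∁D-closed d (V⊆ d d∈V))
      where
      ∁D-closed : Closed a V (∁ D)
      ∁D-closed u w u∈V u∉D w∈V ¬w∉D uw =
        D-closed w u w∈V (decidable-stable (w ∈? D) ¬w∉D) u∈V u∉D (trans (symm c w u) uw)

  open Component

  -- The set grows from `x` by one crossing edge at a time. Each step trades one unit of fuel for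
  -- one vertex, so the invariant `card V ≤ fuel + card A` guarantees that the fuel suffices.
  component : ∀ a V x → x ∈ V → Component a V x
  component a V x x∈V = grow (card V) ⁅ x ⁆ (λ { _ refl → x∈V }) refl (λ { D x∈D _ _ refl → x∈D }) (m≤m+n _ _)
    where
    grow : ∀ fuel A → A ⊆ V → x ∈ A → (∀ D → x ∈ D → Closed a V D → A ⊆ D) →
           card V ≤ fuel + card A → Component a V x
    grow fuel A A⊆V x∈A least enough with crossing? a V A
    grow fuel A A⊆V x∈A least enough | inj₂ A-closed =
      record { set = A ; ⊆V = A⊆V ; root = x∈A ; closed = A-closed ; minimal = least }
    grow zero A A⊆V x∈A least enough | inj₁ (u , w , u∈V , u∈A , w∈V , w∉A , uw) =
      contradiction enough (<⇒≱ (card-⊂ A V A⊆V w w∈V w∉A))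
    grow (suc fuel) A A⊆V x∈A least enough | inj₁ (u , w , u∈V , u∈A , w∈V , w∉A , uw) =
      grow fuel A′ (λ { z (inj₁ z∈A) → A⊆V z z∈A ; z (inj₂ refl) → w∈V }) (inj₁ x∈A) least′
        (≤-trans enough (≤-trans (≤-reflexive (sym (+-suc fuel (card A))))
          (+-monoʳ-≤ fuel (card-⊂ A A′ (λ _ → inj₁) w (inj₂ refl) w∉A))))
      where
      A′ : Subset N
      A′ = A ∪ ⁅ w ⁆
      least′ : ∀ D → x ∈ D → Closed a V D → A′ ⊆ D
      least′ D x∈D D-closed z (inj₁ z∈A) = least D x∈D D-closed z z∈A
      least′ D x∈D D-closed z (inj₂ refl) = decidable-stable (w ∈? D) λ w∉D →
        D-closed u w u∈V (least D x∈D D-closed u u∈A) w∈V w∉D uw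

  spanning? : ∀ {a V x} (C : Component a V x) → Connected a V ⊎ (∃ λ z → z ∈ V × z ∉ set C)
  spanning? {V = V} C with any? (λ z → z ∈? V ×-dec ¬? (z ∈? set C))
  ... | yes outside = inj₂ outside
  ... | no  ∄ = inj₁ (spanning⇒connected C λ z z∈V → decidable-stable (z ∈? set C) λ z∉ → ∄ (z , z∈V , z∉))

  infixl 6 _-_
  _-_ : Subset N → Fin N → Subset N
  (V - v) .Mem y = y ∈ V × v ≢ y
  (V - v) .mem? y = y ∈? V ×-dec ¬? (v ≟ y)

  card-- : ∀ V v → v ∈ V → card (V - v) < card V
  card-- V v v∈V = card-⊂ (V - v) V (λ _ → proj₁) v v∈V (λ (_ , v≢v) → v≢v refl)

  exit : ∀ {a V v y} → Connected a V → v ∈ V → y ∈ (V - v) → ∃ λ w → w ∈ (V - v) × col c v w ≡ a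
  exit {v = v} {y} conn v∈V (y∈V , v≢y) with conn ⁅ v ⁆ v y v∈V refl y∈V v≢y
  ... | _ , w , _ , refl , w∈V , v≢w , vw = w , (w∈V , v≢w) , vw

  module _ {a b d V v y₀} (a≢b : a ≢ b) (a≢d : a ≢ d) (b≢d : b ≢ d) (v∈V : v ∈ V) (y₀∈ : y₀ ∈ (V - v))
           (conn-a : Connected a V) (conn-b : Connected b V) (conn-d : Connected d V) where

    -- Colour `a` is connected on `V`, so it leaves the component; inside `V - v` nothing leaves it,
    -- so the edge ends in `v`.
    attach : ∀ {w} (C : Component a (V - v) w) → ∃ λ z → z ∈ set C × col c v z ≡ a
    attach {w} C with conn-a (set C) w v (proj₁ (⊆V C w (root C))) (root C) v∈V (λ v∈C → proj₂ (⊆V C v v∈C) refl)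
    ... | u , t , u∈V , u∈C , t∈V , t∉C , ut with v ≟ t
    ...   | yes refl = u , u∈C , trans (symm c v u) ut
    ...   | no  v≢t  = contradiction ut (closed C u t (⊆V C u u∈C) u∈C (t∈V , v≢t) t∉C)

    -- The triangle `vxz` has the distinct colours `e` and `a` at `v`, so its third side has one of
    -- them.
    forced : ∀ {e x z} → a ≢ e → x ∈ (V - v) → z ∈ (V - v) → x ≢ z →
             col c v x ≡ e → col c v z ≡ a → col c x z ≢ a → col c x z ≡ e
    forced {e} {x} {z} a≢e (_ , v≢x) (_ , v≢z) x≢z vx vz xz≢a =
      trans (symm c x z) (trans (no-rainbow v≢z (x≢z ∘ sym) v≢x
        (λ vz≡vx → a≢e (trans (sym vz) (trans vz≡vx vx)))
        (λ zx≡vz → xz≢a (trans (symm c x z) (trans zx≡vz vz)))) vx)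

    -- Take `x` and `y` joined to `v` in colours `b` and `d`. If colour `a` falls apart without `v`,
    -- vertices joined to `v` in colour `a` in different components force edges of colours `b` and
    -- `d` that homogeneity makes equal. The double negation is harmless because only a
    -- contradiction is drawn from it.
    deletion-connected : ¬ ¬ Connected a (V - v)
    deletion-connected disconnected with exit {V = V} {v} {y₀} conn-b v∈V y₀∈ | exit {V = V} {v} {y₀} conn-d v∈V y₀∈
    ... | x , x∈ , vx | y , y∈ , vy with component a (V - v) x x∈
    ...   | C with y ∈? set C
    ...     | yes y∈C with spanning? C
    ...       | inj₁ connected = disconnected connected
    ...       | inj₂ (z , z∈ , z∉C) with component a (V - v) z z∈
    -- Here `x` and `y` share a component. The vertex `z′` of another component sees `x` in colour
    -- `b` and `y` in colour `d`, but homogeneity makes these colours equal.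
    ...         | F with attach F
    ...           | z′ , z′∈F , vz′ = b≢d (trans (sym xz′) (trans
                      (trans (symm c x z′) (trans (sym (homogeneous C y∈C (⊆V F z′ z′∈F) z′∉C)) (symm c z′ y))) yz′))
      where
      z′∉C : z′ ∉ set C
      z′∉C = minimal F (∁ (set C)) z∉C (λ u w u∈ u∉C w∈ ¬w∉C uw →
        closed C w u w∈ (decidable-stable (w ∈? set C) ¬w∉C) u∈ u∉C (trans (symm c w u) uw)) z′ z′∈F
      apart : ∀ {u} → u ∈ set C → u ≢ z′
      apart u∈C refl = z′∉C u∈C
      xz′ : col c x z′ ≡ b
      xz′ = forced a≢b x∈ (⊆V F z′ z′∈F) (apart (root C)) vx vz′
              (closed C x z′ x∈ (root C) (⊆V F z′ z′∈F) z′∉C)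
      yz′ : col c y z′ ≡ d
      yz′ = forced a≢d y∈ (⊆V F z′ z′∈F) (apart y∈C) vy vz′
              (closed C y z′ y∈ y∈C (⊆V F z′ z′∈F) z′∉C)
    deletion-connected disconnected | x , x∈ , vx | y , y∈ , vy | C | no y∉C
      with component a (V - v) y y∈
    -- Now `x` and `y` lie in different components. The edges `xz` and `yw` have colours `b` and
    -- `d`, and homogeneity of `E` and of `C` carries both colours over to the edge `xy`.
    ... | E with attach C | attach E
    ...   | w , w∈C , vw | z , z∈E , vz = b≢d (trans (sym xy≡b) xy≡d)
      where
      E⊆∁C : set E ⊆ (∁ (set C))
      E⊆∁C = minimal E (∁ (set C)) y∉C (λ u w u∈ u∉C w∈ ¬w∉C uw →
        closed C w u w∈ (decidable-stable (w ∈? set C) ¬w∉C) u∈ u∉C (trans (symm c w u) uw))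
      apart : ∀ {p q} → p ∈ set C → q ∈ set E → p ≢ q
      apart p∈C q∈E refl = E⊆∁C _ q∈E p∈C
      x∉E : x ∉ set E
      x∉E x∈E = E⊆∁C x x∈E (root C)
      xz : col c x z ≡ b
      xz = forced a≢b x∈ (⊆V E z z∈E) (apart (root C) z∈E) vx vz
             (closed C x z x∈ (root C) (⊆V E z z∈E) (E⊆∁C z z∈E))
      yw : col c y w ≡ d
      yw = forced a≢d y∈ (⊆V C w w∈C) (apart w∈C (root E) ∘ sym) vy vw
             (λ yw≡a → closed C w y (⊆V C w w∈C) w∈C y∈ y∉C (trans (symm c w y) yw≡a))
      xy≡b : col c x y ≡ b
      xy≡b = trans (sym (homogeneous E z∈E x∈ x∉E)) xz
      xy≡d : col c x y ≡ d
      xy≡d = trans (symm c x y) (trans (sym (homogeneous C w∈C y∈ y∉C)) yw)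

  -- Induction by deleting `x`: all three colours stay connected as long as two other vertices
  -- remain.
  at-most-two-connected : ∀ n V → card V ≤ n → ∀ {x y} → x ∈ V → y ∈ V → x ≢ y →
    ∀ {a b d} → a ≢ b → a ≢ d → b ≢ d → Connected a V → Connected b V → ¬ Connected d V
  at-most-two-connected zero V small x∈V y∈V x≢y a≢b a≢d b≢d conn-a conn-b conn-d =
    contradiction (≤-trans (card-∈ V _ x∈V) small) λ ()
  at-most-two-connected (suc n) V small {x} {y} x∈V y∈V x≢y {a} {b} a≢b a≢d b≢d conn-a conn-b conn-d
    with any? (λ z → z ∈? (V - x) ×-dec ¬? (y ≟ z))
  ... | yes (z , z∈ , y≢z) =
        deletion-connected {V = V} {x} {y} a≢b a≢d b≢d x∈V y∈ conn-a conn-b conn-d λ conn-a′ →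
        deletion-connected {V = V} {x} {y} (a≢b ∘ sym) b≢d a≢d x∈V y∈ conn-b conn-a conn-d λ conn-b′ →
        deletion-connected {V = V} {x} {y} (a≢d ∘ sym) (b≢d ∘ sym) a≢b x∈V y∈ conn-d conn-a conn-b λ conn-d′ →
        at-most-two-connected n (V - x) (s≤s⁻¹ (≤-trans (card-- V x x∈V) small)) y∈ z∈ y≢z
          a≢b a≢d b≢d conn-a′ conn-b′ conn-d′
    where
    y∈ : y ∈ (V - x)
    y∈ = y∈V , x≢y
  -- Only `x` and `y` are left, and their single edge would need several colours.
  ... | no ∄ = a≢b (trans (sym (xy conn-a)) (xy conn-b))
    where
    xy : ∀ {e} → Connected e V → col c x y ≡ e
    xy conn with exit {V = V} {x} {y} conn x∈V (y∈V , x≢y)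
    ... | w , w∈ , xw with y ≟ w
    ...   | yes refl = xw
    ...   | no  y≢w  = contradiction (w , w∈ , y≢w) ∄

  -- The partition is encoded by a retraction onto chosen representatives, so the reduced colouring
  -- is the original one restricted to them. Colours inside a part are unrestricted.
  record Decomposition (V : Subset N) (a b : Fin k) : Set where
    field
      part      : Fin N → Fin N
      part-∈    : ∀ {x} → x ∈ V → part x ∈ V
      part-idem : ∀ {x} → x ∈ V → part (part x) ≡ part x
      part-col  : ∀ {x y} → x ∈ V → y ∈ V → part x ≢ part y → col c x y ≡ col c (part x) (part y)
      part-two  : ∀ {x y} → x ∈ V → y ∈ V → part x ≢ part y → col c x y ≡ a ⊎ col c x y ≡ b
      proper    : ∃ λ x → ∃ λ y → x ∈ V × y ∈ V × part x ≢ part y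

  Decomposable : Subset N → Set
  Decomposable V = ∃ λ a → ∃ λ b → Decomposition V a b

  -- A component may be shrunk to its root, since by homogeneity every outside vertex sees it in one
  -- colour. Decompositions of the contracted set then pull back along `collapse`.
  module Contraction {a V x} (C : Component a V x) where

    contracted : Subset N
    contracted .Mem y = y ∈ V × (y ∉ set C ⊎ x ≡ y)
    contracted .mem? y = y ∈? V ×-dec (¬? (y ∈? set C) ⊎-dec x ≟ y)

    collapse : Fin N → Fin N
    collapse y = if does (y ∈? set C) then x else y

    root∈ : x ∈ contracted
    root∈ = ⊆V C x (root C) , inj₂ refl

    collapse-∈ : ∀ {y} → y ∈ V → collapse y ∈ contracted
    collapse-∈ {y} y∈V with y ∈? set C
    ... | yes _   = root∈
    ... | no  y∉C = y∈V , inj₁ y∉C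

    collapse-fixed : ∀ {y} → y ∈ contracted → collapse y ≡ y
    collapse-fixed {y} (y∈V , alternatives) with y ∈? set C | alternatives
    ... | no  _   | _         = refl
    ... | yes _   | inj₂ x≡y  = x≡y
    ... | yes y∈C | inj₁ y∉C  = contradiction y∈C y∉C

    collapse-col : ∀ {y z} → y ∈ V → z ∈ V → collapse y ≢ collapse z →
                   col c y z ≡ col c (collapse y) (collapse z)
    collapse-col {y} {z} y∈V z∈V distinct with y ∈? set C | z ∈? set C
    ... | yes _   | yes _   = contradiction refl distinct
    ... | yes y∈C | no  z∉C = trans (symm c y z) (trans (homogeneous C y∈C z∈V z∉C) (symm c z x))
    ... | no  y∉C | yes z∈C = homogeneous C z∈C y∈V y∉C
    ... | no  _   | no  _   = refl

    expand : Decomposable contracted → Decomposable V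
    expand (p , q , D) = p , q , record
      { part      = part ∘ collapse
      ; part-∈    = λ y∈V → proj₁ (part-∈ (collapse-∈ y∈V))
      ; part-idem = λ y∈V → trans (cong part (collapse-fixed (part-∈ (collapse-∈ y∈V))))
                                  (part-idem (collapse-∈ y∈V))
      ; part-col  = λ y∈V z∈V distinct → trans (collapse-col y∈V z∈V (distinct ∘ cong part))
                                               (part-col (collapse-∈ y∈V) (collapse-∈ z∈V) distinct)
      ; part-two  = λ y∈V z∈V distinct →
          subst (λ e → e ≡ p ⊎ e ≡ q) (sym (collapse-col y∈V z∈V (distinct ∘ cong part)))
            (part-two (collapse-∈ y∈V) (collapse-∈ z∈V) distinct)
      ; proper    = let y , z , y∈ , z∈ , distinct = proper in y , z , proj₁ y∈ , proj₁ z∈ ,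
          subst₂ (λ s t → part s ≢ part t) (sym (collapse-fixed y∈)) (sym (collapse-fixed z∈)) distinct
      }
      where open Decomposition D

  two-coloured? : ∀ a b V →
    TwoColoured a b V ⊎ (∃ λ x → ∃ λ y → x ∈ V × y ∈ V × x ≢ y × col c x y ≢ a × col c x y ≢ b)
  two-coloured? a b V with any? (λ x → any? (λ y →
    x ∈? V ×-dec y ∈? V ×-dec ¬? (x ≟ y) ×-dec ¬? (col c x y ≟ a) ×-dec ¬? (col c x y ≟ b)))
  ... | yes found = inj₂ found
  ... | no  ∄     = inj₁ two
    where
    two : TwoColoured a b V
    two x y x∈V y∈V x≢y with col c x y ≟ a | col c x y ≟ b
    ... | yes xy≡a | _        = inj₁ xy≡a
    ... | no  _    | yes xy≡b = inj₂ xy≡b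
    ... | no  xy≢a | no  xy≢b = contradiction (x , y , x∈V , y∈V , x≢y , xy≢a , xy≢b) ∄

  two-coloured⇒decomposable : ∀ {a b V x y} → x ∈ V → y ∈ V → x ≢ y → TwoColoured a b V → Decomposable V
  two-coloured⇒decomposable x∈V y∈V x≢y two = _ , _ , record
    { part      = id
    ; part-∈    = id
    ; part-idem = λ _ → refl
    ; part-col  = λ _ _ _ → refl
    ; part-two  = λ x∈ y∈ → two _ _ x∈ y∈
    ; proper    = _ , _ , x∈V , y∈V , x≢y
    }

  -- Gallai's theorem. Given edges of three colours, some colour is not connected on `V`, as at most
  -- two can be. The component of that colour around its edge is contracted, and induction applies
  -- to the smaller set.
  decompose : ∀ n V → card V ≤ n → ∀ {x y} → x ∈ V → y ∈ V → x ≢ y → Decomposable V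
  decompose zero    V small x∈V y∈V x≢y = contradiction (≤-trans (card-∈ V _ x∈V) small) λ ()
  -- With the same colour passed twice, the test asks whether `V` is monochromatic.
  decompose (suc n) V small {x₁} {y₁} x₁∈ y₁∈ x₁≢y₁ with two-coloured? (col c x₁ y₁) (col c x₁ y₁) V
  ... | inj₁ two = two-coloured⇒decomposable x₁∈ y₁∈ x₁≢y₁ two
  ... | inj₂ (x₂ , y₂ , x₂∈ , y₂∈ , x₂≢y₂ , 2≢1 , _) with two-coloured? (col c x₁ y₁) (col c x₂ y₂) V
  ...   | inj₁ two = two-coloured⇒decomposable x₁∈ y₁∈ x₁≢y₁ two
  ...   | inj₂ (x₃ , y₃ , x₃∈ , y₃∈ , x₃≢y₃ , 3≢1 , 3≢2)
    with contract-or-connected x₁∈ y₁∈ x₁≢y₁ | contract-or-connected x₂∈ y₂∈ x₂≢y₂ | contract-or-connected x₃∈ y₃∈ x₃≢y₃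
    where
    contract-or-connected : ∀ {x y} → x ∈ V → y ∈ V → x ≢ y → Connected (col c x y) V ⊎ Decomposable V
    contract-or-connected {x} {y} x∈V y∈V x≢y with component (col c x y) V x x∈V
    ... | C with spanning? C
    ...   | inj₁ connected      = inj₁ connected
    -- The contraction loses `y` but keeps the two vertices `x` and `z`.
    ...   | inj₂ (z , z∈V , z∉C) = inj₂ (expand (decompose n contracted
              (s≤s⁻¹ (≤-trans (card-⊂ contracted V (λ _ → proj₁) y y∈V
                (λ { (_ , inj₁ y∉C) → y∉C y∈C ; (_ , inj₂ x≡y) → x≢y x≡y })) small))
              root∈ (z∈V , inj₁ z∉C) (λ { refl → z∉C (root C) })))
      where
      open Contraction C
      y∈C : y ∈ set C
      y∈C = decidable-stable (y ∈? set C) λ y∉C → closed C x y x∈V (root C) y∈V y∉C refl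
  ...     | inj₂ done | _         | _         = done
  ...     | inj₁ _    | inj₂ done | _         = done
  ...     | inj₁ _    | inj₁ _    | inj₂ done = done
  ...     | inj₁ conn₁ | inj₁ conn₂ | inj₁ conn₃ = contradiction conn₃
            (at-most-two-connected (suc n) V small x₁∈ y₁∈ x₁≢y₁ (2≢1 ∘ sym) (3≢1 ∘ sym) (3≢2 ∘ sym) conn₁ conn₂)

-- Weights

-- What is known about a colour class: it has no edge, no K₃, or no K₄ + e.
data State : Set where
  none tri star : State

-- The sum of the ranks drives the induction. A clique bound of `clique x` guarantees state `x`; for
-- `star` it means K₄-free, which is stronger than (K₄ + e)-free.
#star #tri rank clique : State → ℕ
#star none = 0
#star tri  = 0
#star star = 1
#tri none = 0
#tri tri  = 1
#tri star = 0
rank none = 0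
rank tri  = 1
rank star = 2
clique x = suc (rank x)

starBound triBound : ℕ → ℕ
starBound 0 = 1
starBound 1 = 4
starBound (suc (suc n)) = 17 * starBound n
triBound 0 = 1
triBound 1 = 2
triBound (suc (suc n)) = 5 * triBound n

starBound>0 : ∀ n → 1 ≤ starBound n
starBound>0 0 = s≤s z≤n
starBound>0 1 = s≤s z≤n
starBound>0 (suc (suc n)) = *-mono-≤ {1} {17} (s≤s z≤n) (starBound>0 n)

triBound>0 : ∀ n → 1 ≤ triBound n
triBound>0 0 = s≤s z≤n
triBound>0 1 = s≤s z≤n
triBound>0 (suc (suc n)) = *-mono-≤ {1} {5} (s≤s z≤n) (triBound>0 n)

weight : ∀ {k} → (Fin k → State) → ℕ
weight s = starBound (sum (#star ∘ s)) * triBound (sum (#tri ∘ s))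

starBound-+ : ∀ h n → starBound (h * 2 + n) ≡ starBound n * 17 ^ h
starBound-+ zero    n = sym (*-identityʳ _)
starBound-+ (suc h) n = trans (cong (17 *_) (starBound-+ h n))
  (solve 2 (λ u v → con 17 :* (u :* v) := u :* (con 17 :* v)) refl (starBound n) (17 ^ h))
  where open +-*-Solver

triBound-+ : ∀ h n → triBound (h * 2 + n) ≡ triBound n * 5 ^ h
triBound-+ zero    n = sym (*-identityʳ _)
triBound-+ (suc h) n = trans (cong (5 *_) (triBound-+ h n))
  (solve 2 (λ u v → con 5 :* (u :* v) := u :* (con 5 :* v)) refl (triBound n) (5 ^ h))
  where open +-*-Solver

-- The weight of two colours in states x and y, in units of 17ʰ 5ʲ, when the numbers of the
-- other colours in states star and tri are 2h + p and 2j + q.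
coef : Fin 2 → Fin 2 → State → State → ℕ
coef p q x y = starBound ((#star x + #star y) + toℕ p) * triBound ((#tri x + #tri y) + toℕ q)

-- Both bounds are multiplied by a constant when their argument grows by 2. Pulling out these
-- factors leaves only the parities `p` and `q`, so the inequalities between weights become finite
-- checks.
rescale : ∀ A B → ∃ λ p → ∃ λ q → ∃ λ X → 1 ≤ X ×
  (∀ x y → starBound ((#star x + #star y) + A) * triBound ((#tri x + #tri y) + B) ≡ coef p q x y * X)
rescale A B with A divMod 2 | B divMod 2
... | result h p refl | result j q refl = p , q , 17 ^ h * 5 ^ j ,
  *-mono-≤ (m^n>0 17 h) (m^n>0 5 j) , λ x y →
    trans (cong₂ _*_ (trans (cong starBound (shift (#star x + #star y) (toℕ p) (h * 2))) (starBound-+ h _))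
                     (trans (cong triBound (shift (#tri x + #tri y) (toℕ q) (j * 2))) (triBound-+ j _)))
      (solve 4 (λ u v U V → (u :* U) :* (v :* V) := (u :* v) :* (U :* V)) refl
        (starBound (#star x + #star y + toℕ p)) (triBound (#tri x + #tri y + toℕ q)) (17 ^ h) (5 ^ j))
  where
  open +-*-Solver
  shift : ∀ a b c → a + (b + c) ≡ c + (a + b)
  shift = solve 3 (λ a b c → a :+ (b :+ c) := c :+ (a :+ b)) refl

-- Assignments that differ in one or two colours

module _ {k : ℕ} where

  assign : Fin k → State → (Fin k → State) → Fin k → State
  assign a x s = updateAt s a (const x)

  sum-assign : (f : State → ℕ) → f none ≡ 0 → ∀ a (s : Fin k → State) →
               sum (f ∘ s) ≡ f (s a) + sum (f ∘ assign a none s)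
  sum-assign f f-none a s = begin
    sum (f ∘ s)
      ≡⟨ sum-cong-≗ pointwise ⟩
    sum (λ c → indicator (a ≟ c) * f (s a) + f (assign a none s c))
      ≡⟨ ∑-distrib-+ {k} _ _ ⟩
    sum (λ c → indicator (a ≟ c) * f (s a)) + sum (f ∘ assign a none s)
      ≡⟨ cong (_+ sum (f ∘ assign a none s)) (trans (sym (*-distribʳ-sum (f (s a)) (λ c → indicator (a ≟ c))))
           (trans (cong (_* f (s a)) (card-⁅⁆ a)) (*-identityˡ _))) ⟩
    f (s a) + sum (f ∘ assign a none s) ∎
    where
    open ≡-Reasoning
    pointwise : ∀ c → f (s c) ≡ indicator (a ≟ c) * f (s a) + f (assign a none s c)
    pointwise c with a ≟ c
    ... | yes refl = sym (trans (cong₂ _+_ (*-identityˡ (f (s a)))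
                       (trans (cong f (updateAt-updates a s)) f-none)) (+-identityʳ _))
    ... | no  a≢c  = cong f (sym (updateAt-minimal c a s (a≢c ∘ sym)))

  Agree₁ : Fin k → (s t : Fin k → State) → Set
  Agree₁ a s t = ∀ c → a ≢ c → t c ≡ s c

  Agree₂ : Fin k → Fin k → (s t : Fin k → State) → Set
  Agree₂ a b s t = ∀ c → a ≢ c → b ≢ c → t c ≡ s c

  sum-agree₁ : (f : State → ℕ) → f none ≡ 0 → ∀ a s t → Agree₁ a s t →
               sum (f ∘ t) ≡ f (t a) + sum (f ∘ assign a none s)
  sum-agree₁ f f-none a s t agree =
    trans (sum-assign f f-none a t) (cong (f (t a) +_) (sum-cong-≗ (cong f ∘ same)))
    where
    same : ∀ c → assign a none t c ≡ assign a none s c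
    same c with a ≟ c
    ... | yes refl = trans (updateAt-updates a t) (sym (updateAt-updates a s))
    ... | no  a≢c  = trans (updateAt-minimal c a t (a≢c ∘ sym))
                       (trans (agree c a≢c) (sym (updateAt-minimal c a s (a≢c ∘ sym))))

  sum-agree₂ : (f : State → ℕ) → f none ≡ 0 → ∀ a b → a ≢ b → ∀ s t → Agree₂ a b s t →
               sum (f ∘ t) ≡ (f (t a) + f (t b)) + sum (f ∘ assign b none (assign a none s))
  sum-agree₂ f f-none a b a≢b s t agree = begin
    sum (f ∘ t)
      ≡⟨ sum-assign f f-none a t ⟩
    f (t a) + sum (f ∘ assign a none t)
      ≡⟨ cong (f (t a) +_) (sum-agree₁ f f-none b (assign a none s) (assign a none t) same) ⟩
    f (t a) + (f (assign a none t b) + sum (f ∘ assign b none (assign a none s)))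
      ≡⟨ cong (λ x → f (t a) + (f x + _)) (updateAt-minimal b a t (a≢b ∘ sym)) ⟩
    f (t a) + (f (t b) + sum (f ∘ assign b none (assign a none s)))
      ≡⟨ sym (+-assoc (f (t a)) _ _) ⟩
    (f (t a) + f (t b)) + sum (f ∘ assign b none (assign a none s)) ∎
    where
    open ≡-Reasoning
    same : Agree₁ b (assign a none s) (assign a none t)
    same c b≢c with a ≟ c
    ... | yes refl = trans (updateAt-updates a t) (sym (updateAt-updates a s))
    ... | no  a≢c  = trans (updateAt-minimal c a t (a≢c ∘ sym))
                       (trans (agree c a≢c b≢c) (sym (updateAt-minimal c a s (a≢c ∘ sym))))

  sum-agree₁-< : (f : State → ℕ) → f none ≡ 0 → ∀ a s t → Agree₁ a s t → f (t a) < f (s a) →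
                 sum (f ∘ t) < sum (f ∘ s)
  sum-agree₁-< f f-none a s t agree lt = subst₂ _<_ (sym (sum-agree₁ f f-none a s t agree))
    (sym (sum-agree₁ f f-none a s s (λ _ _ → refl))) (+-monoˡ-< _ lt)

  sum-agree₂-< : (f : State → ℕ) → f none ≡ 0 → ∀ a b → a ≢ b → ∀ s t → Agree₂ a b s t →
                 f (t a) + f (t b) < f (s a) + f (s b) → sum (f ∘ t) < sum (f ∘ s)
  sum-agree₂-< f f-none a b a≢b s t agree lt = subst₂ _<_ (sym (sum-agree₂ f f-none a b a≢b s t agree))
    (sym (sum-agree₂ f f-none a b a≢b s s (λ _ _ _ → refl))) (+-monoˡ-< _ lt)

  -- The unit `X` is fixed by the colours other than `a`, hence common to all assignments that agree
  -- with `s` there. The second place of `coef` is filled with `none`, which contributes nothing.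
  weight₁ : ∀ a s → ∃ λ p → ∃ λ q → ∃ λ X → 1 ≤ X ×
            (∀ t → Agree₁ a s t → weight t ≡ coef p q (t a) none * X)
  weight₁ a s with rescale (sum (#star ∘ assign a none s)) (sum (#tri ∘ assign a none s))
  ... | p , q , X , 1≤X , scaled = p , q , X , 1≤X , λ t agree →
    trans (cong₂ (λ m n → starBound m * triBound n) (total #star refl t agree) (total #tri refl t agree))
          (scaled (t a) none)
    where
    total : (f : State → ℕ) → f none ≡ 0 → ∀ t → Agree₁ a s t →
            sum (f ∘ t) ≡ (f (t a) + f none) + sum (f ∘ assign a none s)
    total f f-none t agree rewrite f-none | +-identityʳ (f (t a)) = sum-agree₁ f f-none a s t agree

  weight₂ : ∀ a b → a ≢ b → ∀ s → ∃ λ p → ∃ λ q → ∃ λ X → 1 ≤ X ×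
            (∀ t → Agree₂ a b s t → weight t ≡ coef p q (t a) (t b) * X)
  weight₂ a b a≢b s with rescale (sum (#star ∘ assign b none (assign a none s)))
                                 (sum (#tri ∘ assign b none (assign a none s)))
  ... | p , q , X , 1≤X , scaled = p , q , X , 1≤X , λ t agree →
    trans (cong₂ (λ m n → starBound m * triBound n)
            (sum-agree₂ #star refl a b a≢b s t agree) (sum-agree₂ #tri refl a b a≢b s t agree))
          (scaled (t a) (t b))

scale₂ : ∀ {e₁ e₂ e m₁ m₂} X → e₁ + e₂ ≤ e → m₁ ≤ e₁ * X → m₂ ≤ e₂ * X → m₁ + m₂ ≤ e * X
scale₂ {e₁} {e₂} X e≤ m₁≤ m₂≤ = ≤-trans (+-mono-≤ m₁≤ m₂≤)
  (≤-trans (≤-reflexive (sym (*-distribʳ-+ X e₁ e₂))) (*-monoˡ-≤ X e≤))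

scale₃ : ∀ {e₁ e₂ e₃ e m₁ m₂ m₃} X → e₁ + (e₂ + e₃) ≤ e →
         m₁ ≤ e₁ * X → m₂ ≤ e₂ * X → m₃ ≤ e₃ * X → m₁ + (m₂ + m₃) ≤ e * X
scale₃ {e₁} {e₂} {e₃} X e≤ m₁≤ m₂≤ m₃≤ =
  scale₂ {e₁} {e₂ + e₃} X e≤ m₁≤ (scale₂ {e₂} {e₃} X ≤-refl m₂≤ m₃≤)

scale-* : ∀ {e e′ m} n X → n * e ≤ e′ → m ≤ n * (e * X) → m ≤ e′ * X
scale-* {e} n X e≤ m≤ = ≤-trans m≤ (≤-trans (≤-reflexive (sym (*-assoc n e X))) (*-monoˡ-≤ X e≤))

-- A bound, again in units of 17ʰ 5ʲ, for a union of parts without K₄ in the first colour and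
-- without K₃ in the second, when no part contains a K₃ in either: the largest left-hand side in
-- Bounds₃₂. For p = q = 1 the general bound coef p q star tri = 85 would be too weak.
coef₃₂ : Fin 2 → Fin 2 → ℕ
coef₃₂ zero       zero       = 8
coef₃₂ zero       (suc zero) = 18
coef₃₂ (suc zero) zero       = 33
coef₃₂ (suc zero) (suc zero) = 74

-- The inequalities match the cases of `bound₃₂`: parts without edges of the reduced colours, then a
-- part with edges of the second colour only, of both, and of the first only. The last three add the
-- bounds for the part and its neighbourhoods in the first and second colour.
Bounds₃₂ : (State → State → ℕ) → ℕ → Set
Bounds₃₂ e m = 8 * e none none ≤ m × e none tri + (e tri tri + 0) ≤ m ×
               e tri tri + (e none tri + 0) ≤ m × e tri none + (e none tri + e star none) ≤ m

bounds₃₂? : ∀ e m → Dec (Bounds₃₂ e m)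
bounds₃₂? e m = _ ≤? _ ×-dec _ ≤? _ ×-dec _ ≤? _ ×-dec _ ≤? _

coef₃₂-bounds : ∀ p q → Bounds₃₂ (coef p q) (coef₃₂ p q)
coef₃₂-bounds = from-yes (all? λ p → all? λ q → bounds₃₂? (coef p q) (coef₃₂ p q))

coef₃₂-bounds′ : ∀ p q → Bounds₃₂ (λ x y → coef p q y x) (coef₃₂ p q)
coef₃₂-bounds′ = from-yes (all? λ p → all? λ q → bounds₃₂? (λ x y → coef p q y x) (coef₃₂ p q))

-- The upper bound

module UpperBound {N k : ℕ} (c : EdgeColoring N k) (gallai : Gallai c) where

  open Cliques c
  open Structure c gallai

  K₄ : Fin k → Subset N → (x y z w : Fin N) → Set
  K₄ a S x y z w = (x ∈ S × y ∈ S × z ∈ S × w ∈ S) ×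
                   (Adj a x y × Adj a x z × Adj a x w) × (Adj a y z × Adj a y w) × Adj a z w

  PendantFree : Fin k → Subset N → Set
  PendantFree a S = ∀ x y z w t → K₄ a S x y z w → t ∈ S → Adj a x t → y ≢ t → z ≢ t → w ≢ t → ⊥

  Avoids : State → Fin k → Subset N → Set
  Avoids none a S = Free a 1 S
  Avoids tri  a S = Free a 2 S
  Avoids star a S = PendantFree a S

  Avoids-⊆ : ∀ x {a} S T → S ⊆ T → Avoids x a T → Avoids x a S
  Avoids-⊆ none = Free-⊆ 1
  Avoids-⊆ tri  = Free-⊆ 2
  Avoids-⊆ star S T S⊆T free x y z w t ((x∈ , y∈ , z∈ , w∈) , edges) t∈ =
    free x y z w t ((S⊆T x x∈ , S⊆T y y∈ , S⊆T z z∈ , S⊆T w w∈) , edges) (S⊆T t t∈)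

  Free⇒Avoids : ∀ x {a} S → Free a (clique x) S → Avoids x a S
  Free⇒Avoids none S free = free
  Free⇒Avoids tri  S free = free
  Free⇒Avoids star S free x y z w _
    ((x∈ , y∈ , z∈ , w∈) , (xy , xz , xw) , (yz , yw) , zw) _ _ _ _ _ =
    free x x∈ y (y∈ , xy) z ((z∈ , xz) , yz) w (((w∈ , xw) , yw) , zw)

  Quad : (x y z w : Fin N) → Subset N
  Quad x y z w = (⁅ x ⁆ ∪ ⁅ y ⁆) ∪ (⁅ z ⁆ ∪ ⁅ w ⁆)

  -- A K₄ of a connected colour has an edge leaving it, unless it is everything.
  connected⇒Free₃ : ∀ a V → Connected a V → 5 ≤ card V → PendantFree a V → Free a 3 V
  connected⇒Free₃ a V connected 5≤ free x x∈ y (y∈ , xy) z ((z∈ , xz) , yz) w (((w∈ , xw) , yw) , zw)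
    with any? (λ t → t ∈? V ×-dec ¬? (t ∈? (Quad x y z w)))
  ... | no ∄ = contradiction 5≤ (≤⇒≯ (≤-trans
          (card-cover V (⁅ x ⁆ ∪ ⁅ y ⁆) (⁅ z ⁆ ∪ ⁅ w ⁆) λ t t∈ → decidable-stable (t ∈? Quad x y z w) λ t∉ → ∄ (t , t∈ , t∉))
          (+-mono-≤ (pair x y) (pair z w))))
    where
    pair : ∀ u v → card (⁅ u ⁆ ∪ ⁅ v ⁆) ≤ 2
    pair u v = ≤-trans (card-cover (⁅ u ⁆ ∪ ⁅ v ⁆) ⁅ u ⁆ ⁅ v ⁆ (λ _ → id))
                       (≤-reflexive (cong₂ _+_ (card-⁅⁆ u) (card-⁅⁆ v)))
  -- The crossing edge starts at one of the four clique vertices; each case lists that vertex first,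
  -- as the one carrying the pendant edge.
  ... | yes (t , t∈ , t∉) with connected (Quad x y z w) x t x∈ (inj₁ (inj₁ refl)) t∈ t∉
  ...   | _ , v , _ , inj₁ (inj₁ refl) , v∈ , v∉ , uv =
          free x y z w v ((x∈ , y∈ , z∈ , w∈) , (xy , xz , xw) , (yz , yw) , zw) v∈ (v∉ ∘ inj₁ ∘ inj₁ , uv)
            (v∉ ∘ inj₁ ∘ inj₂) (v∉ ∘ inj₂ ∘ inj₁) (v∉ ∘ inj₂ ∘ inj₂)
  ...   | _ , v , _ , inj₁ (inj₂ refl) , v∈ , v∉ , uv =
          free y x z w v ((y∈ , x∈ , z∈ , w∈) , (adj-sym xy , yz , yw) , (xz , xw) , zw) v∈ (v∉ ∘ inj₁ ∘ inj₂ , uv)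
            (v∉ ∘ inj₁ ∘ inj₁) (v∉ ∘ inj₂ ∘ inj₁) (v∉ ∘ inj₂ ∘ inj₂)
  ...   | _ , v , _ , inj₂ (inj₁ refl) , v∈ , v∉ , uv =
          free z x y w v ((z∈ , x∈ , y∈ , w∈) , (adj-sym xz , adj-sym yz , zw) , (xy , xw) , yw) v∈ (v∉ ∘ inj₂ ∘ inj₁ , uv)
            (v∉ ∘ inj₁ ∘ inj₁) (v∉ ∘ inj₁ ∘ inj₂) (v∉ ∘ inj₂ ∘ inj₂)
  ...   | _ , v , _ , inj₂ (inj₂ refl) , v∈ , v∉ , uv =
          free w x y z v ((w∈ , x∈ , y∈ , z∈) , (adj-sym xw , adj-sym yw , adj-sym zw) , (xy , xz) , yz) v∈ (v∉ ∘ inj₂ ∘ inj₂ , uv)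
            (v∉ ∘ inj₁ ∘ inj₁) (v∉ ∘ inj₁ ∘ inj₂) (v∉ ∘ inj₂ ∘ inj₁)

  flipped : ∀ {V a b} → Decomposition V a b → Decomposition V b a
  flipped D = record
    { part = part ; part-∈ = part-∈ ; part-idem = part-idem ; part-col = part-col
    ; part-two = λ x∈ y∈ distinct → swap (part-two x∈ y∈ distinct) ; proper = proper }
    where open Decomposition D

  -- Parts of a decomposition and their neighbourhoods

  module Parts {V a b} (D : Decomposition V a b) where

    open Decomposition D public

    Part : Fin N → Subset N
    Part x = fibre V part (part x)

    Outer : Fin k → Subset N → Fin N → Subset N
    Outer d S x .Mem y = y ∈ S × part x ≢ part y × col c x y ≡ d
    Outer d S x .mem? y = y ∈? S ×-dec ¬? (part x ≟ part y) ×-dec col c x y ≟ d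

    same-col : ∀ {x u y} → x ∈ V → u ∈ V → y ∈ V → part x ≡ part u → part x ≢ part y → col c x y ≡ col c u y
    same-col {x} {u} {y} x∈ u∈ y∈ xu xy = trans (part-col x∈ y∈ xy)
      (trans (cong (λ p → col c p (part y)) xu) (sym (part-col u∈ y∈ (subst (_≢ part y) xu xy))))

    self : ∀ {x} → x ∈ V → x ∈ Part x
    self x∈ = x∈ , refl

    split : ∀ S x → S ⊆ V → x ∈ S → card S ≤ card (Part x) + (card (Outer a S x) + card (Outer b S x))
    split S x S⊆V x∈ = card-cover₃ S (Part x) (Outer a S x) (Outer b S x) covers
      where
      covers : ∀ y → y ∈ S → y ∈ Part x ⊎ y ∈ Outer a S x ⊎ y ∈ Outer b S x
      covers y y∈ with part x ≟ part y
      ... | yes xy = inj₁ (S⊆V y y∈ , sym xy)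
      ... | no  xy with part-two (S⊆V x x∈) (S⊆V y y∈) xy
      ...   | inj₁ col-a = inj₂ (inj₁ (y∈ , xy , col-a))
      ...   | inj₂ col-b = inj₂ (inj₂ (y∈ , xy , col-b))

    outer-adj : ∀ {d S x u y} → S ⊆ V → x ∈ V → u ∈ Part x → y ∈ Outer d S x → Adj d u y
    outer-adj S⊆V x∈ (u∈ , ux) (y∈ , xy , col-d) =
      (λ { refl → xy (sym ux) }) , trans (sym (same-col x∈ u∈ (S⊆V _ y∈) (sym ux) xy)) col-d

    Outer-Free : ∀ {d} r S x → S ⊆ V → x ∈ S → Free d (suc r) S → Free d r (Outer d S x)
    Outer-Free {d} r S x S⊆V x∈ free = Free-⊆ r (Outer d S x) (nbhd d S x)
      (λ y y∈ → proj₁ y∈ , outer-adj {S = S} S⊆V (S⊆V x x∈) (self (S⊆V x x∈)) y∈) (free x x∈)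

    -- Both ends of an edge inside the part are joined to the whole outer neighbourhood, so they
    -- extend each of its cliques by two.
    Outer-Free₂ : ∀ {d} r S x {u v} → S ⊆ V → x ∈ S → Part x ⊆ S → u ∈ Part x → v ∈ Part x → Adj d u v →
                  Free d (suc (suc r)) S → Free d r (Outer d S x)
    Outer-Free₂ {d} r S x {u} {v} S⊆V x∈ P⊆S u∈ v∈ uv free =
      Free-⊆ r (Outer d S x) (nbhd d (nbhd d S u) v)
        (λ y y∈ → (proj₁ y∈ , outer-adj {S = S} S⊆V (S⊆V x x∈) u∈ y∈) , outer-adj {S = S} S⊆V (S⊆V x x∈) v∈ y∈)
        (free u (P⊆S u u∈) v (P⊆S v v∈ , uv))

    -- The outer neighbour `y` is joined to all of the part and extends each of its cliques by one.
    Part-Free : ∀ {d} r x {y} → x ∈ V → y ∈ Outer d V x → Free d (suc r) V → Free d r (Part x)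
    Part-Free {d} r x {y} x∈ y∈ free = Free-⊆ r (Part x) (nbhd d V y)
      (λ u u∈ → proj₁ u∈ , adj-sym (outer-adj {S = V} (λ _ → id) x∈ u∈ y∈)) (free y (proj₁ y∈))

    Saturated : Subset N → Set
    Saturated S = ∀ x → x ∈ S → Part x ⊆ S

    Outer-Saturated : ∀ d x → x ∈ V → Saturated (Outer d V x)
    Outer-Saturated d x x∈ u (u∈ , xu , col-d) v (v∈ , vu) = v∈ , subst (part x ≢_) (sym vu) xu ,
      trans (symm c x v) (trans (same-col v∈ u∈ x∈ vu (λ vx → xu (trans (sym vx) vu))) (trans (symm c u x) col-d))

    representatives : Subset N → Subset N
    representatives S .Mem x = x ∈ S × part x ≡ x
    representatives S .mem? x = x ∈? S ×-dec part x ≟ x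

    card-representatives : ∀ S m → S ⊆ V → Saturated S → (∀ x → x ∈ S → card (Part x) ≤ m) →
                           card S ≤ card (representatives S) * m
    card-representatives S m S⊆V saturated small =
      card-fibres S (representatives S) part
        (λ x x∈ → saturated x x∈ (part x) (part-∈ (S⊆V x x∈) , part-idem (S⊆V x x∈)) , part-idem (S⊆V x x∈))
        m λ y (y∈ , yy) → ≤-trans (card-⊆ (fibre S part y) (Part y)
          (λ x (x∈ , xy) → S⊆V x x∈ , trans xy (sym yy))) (small y y∈)

    representatives-two : ∀ S → S ⊆ V → TwoColoured a b (representatives S)
    representatives-two S S⊆V x y (x∈ , xx) (y∈ , yy) x≢y =
      part-two (S⊆V x x∈) (S⊆V y y∈) (λ xy → x≢y (trans (sym xx) (trans xy yy)))

    representatives-Free : ∀ {d} r S → Free d r S → Free d r (representatives S)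
    representatives-Free r S = Free-⊆ r (representatives S) S (λ _ → proj₁)

    inner-edge? : ∀ S → (∃ λ x → x ∈ S × ¬ (Free a 1 (Part x) × Free b 1 (Part x))) ⊎
                        (∀ x → x ∈ S → Free a 1 (Part x) × Free b 1 (Part x))
    inner-edge? S with any? (λ x → x ∈? S ×-dec ¬? (free₁? a (Part x) ×-dec free₁? b (Part x)))
    ... | yes found = inj₁ found
    ... | no  ∄     = inj₂ λ x x∈ → decidable-stable (free₁? a (Part x) ×-dec free₁? b (Part x))
                               λ edgy → ∄ (x , x∈ , edgy)

    -- The form in which the induction hypothesis reaches the reduced colours: their two states are
    -- replaced by states of total rank below `r`, and `T` inherits all others from `V`.
    Bounded : (State → State → ℕ) → ℕ → Set₁
    Bounded w r = ∀ x y → rank x + rank y < r → ∀ T → T ⊆ V →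
                  Free a (clique x) T → Free b (clique y) T → card T ≤ w x y

    Part-⊆ : ∀ x → Part x ⊆ V
    Part-⊆ x _ = proj₁

    edgeless-bound : ∀ {w r} n S → 0 < r → Bounded w r → S ⊆ V → Saturated S →
                     (∀ x → x ∈ S → Free a 1 (Part x) × Free b 1 (Part x)) →
                     card (representatives S) ≤ n → card S ≤ n * w none none
    edgeless-bound n S 0<r bounded S⊆V saturated edgeless few = ≤-trans
      (card-representatives S _ S⊆V saturated λ x x∈ →
        bounded none none 0<r (Part x) (Part-⊆ x) (proj₁ (edgeless x x∈)) (proj₂ (edgeless x x∈)))
      (*-monoˡ-≤ _ few)

    outer-free : ∀ {e} S d x r → Free e r S → Free e r (Outer d S x)
    outer-free S d x r = Free-⊆ r (Outer d S x) S (λ _ → proj₁)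

    module _ (S : Subset N) (S⊆V : S ⊆ V) (saturated : Saturated S) where

      -- If no part has an edge of either colour, R(3,4) = 9 leaves at most eight parts. Otherwise
      -- `S` is split around a part with such an edge: an edge of colour `b` empties the
      -- neighbourhood in that colour, since `b` has no triangle, and an edge of colour `a` makes
      -- the neighbourhood in colour `a` free of `a`-edges.
      bound₃₂ : ∀ e m X → Bounds₃₂ e m → Bounded (λ x y → e x y * X) 3 →
                (∀ x → x ∈ V → Free a 2 (Part x) × Free b 2 (Part x)) →
                Free a 3 S → Free b 2 S → card S ≤ m * X
      bound₃₂ e m X (≤₁ , ≤₂ , ≤₃ , ≤₄) bounded parts free-a free-b with inner-edge? S
      ... | inj₂ edgeless = scale-* {e none none} 8 X ≤₁ (edgeless-bound 8 S (s≤s z≤n) bounded S⊆V saturated edgeless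
              (ramsey₂₃ (representatives S) (λ x y x∈ y∈ → swap ∘ representatives-two S S⊆V x y x∈ y∈)
                (representatives-Free 2 S free-b) (representatives-Free 3 S free-a)))
      ... | inj₁ (x , x∈ , edgy) with edge? a (Part x) | edge? b (Part x) | parts x (S⊆V x x∈)
      ...   | inj₁ part-a | inj₁ part-b | _ = contradiction (part-a , part-b) edgy
      ...   | inj₁ part-a | inj₂ (u , v , u∈ , v∈ , uv) | _ , part-b = ≤-trans (split S x S⊆V x∈) (scale₃ {e none tri} {e tri tri} {0} X ≤₂
                (bounded none tri (s≤s (s≤s z≤n)) (Part x) (Part-⊆ x) part-a part-b)
                (bounded tri tri ≤-refl (Outer a S x) (λ y → S⊆V y ∘ proj₁) (Outer-Free 2 S x S⊆V x∈ free-a) (outer-free S a x 2 free-b))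
                (≤-reflexive (card-empty (Outer b S x) (Outer-Free₂ 0 S x S⊆V x∈ (saturated x x∈) u∈ v∈ uv free-b))))
      ...   | inj₂ (u , v , u∈ , v∈ , uv) | inj₂ (u′ , v′ , u′∈ , v′∈ , u′v′) | part-a , part-b =
              ≤-trans (split S x S⊆V x∈) (scale₃ {e tri tri} {e none tri} {0} X ≤₃
                (bounded tri tri ≤-refl (Part x) (Part-⊆ x) part-a part-b)
                (bounded none tri (s≤s (s≤s z≤n)) (Outer a S x) (λ y → S⊆V y ∘ proj₁)
                  (Outer-Free₂ 1 S x S⊆V x∈ (saturated x x∈) u∈ v∈ uv free-a) (outer-free S a x 2 free-b))
                (≤-reflexive (card-empty (Outer b S x) (Outer-Free₂ 0 S x S⊆V x∈ (saturated x x∈) u′∈ v′∈ u′v′ free-b))))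
      ...   | inj₂ (u , v , u∈ , v∈ , uv) | inj₁ part-b | part-a , _ =
              ≤-trans (split S x S⊆V x∈) (scale₃ {e tri none} {e none tri} {e star none} X ≤₄
                (bounded tri none (s≤s (s≤s z≤n)) (Part x) (Part-⊆ x) part-a part-b)
                (bounded none tri (s≤s (s≤s z≤n)) (Outer a S x) (λ y → S⊆V y ∘ proj₁)
                  (Outer-Free₂ 1 S x S⊆V x∈ (saturated x x∈) u∈ v∈ uv free-a) (outer-free S a x 2 free-b))
                (bounded star none ≤-refl (Outer b S x) (λ y → S⊆V y ∘ proj₁)
                  (outer-free S b x 3 free-a) (Outer-Free 1 S x S⊆V x∈ free-b)))

    Attached : Fin k → Set
    Attached d = ∀ x → x ∈ V → ∃ λ y → y ∈ Outer d V x

  module _ {V a b} (D : Decomposition V a b)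
           (attached-a : Parts.Attached D a) (attached-b : Parts.Attached D b) where

    open Parts D
    private module Flip = Parts (flipped D)

    V-saturated : Saturated V
    V-saturated x x∈ = Part-⊆ x

    parts-free : ∀ r q → Free a (suc r) V → Free b (suc q) V → ∀ x → x ∈ V → Free a r (Part x) × Free b q (Part x)
    parts-free r q free-a free-b x x∈ =
      Part-Free r x x∈ (proj₂ (attached-a x x∈)) free-a , Part-Free q x x∈ (proj₂ (attached-b x x∈)) free-b

    -- State `none` contradicts attachment. Every part misses one vertex of the largest permitted
    -- clique, because an outside vertex would complete it; so for two `tri` the parts have no edges
    -- in the reduced colours and there are at most five. Mixed states are `bound₃₂`. For two `star`
    -- there are at most 17 parts without such edges, or else `V` is split around a part with an
    -- edge.
    prime-bound : ∀ p q X x y → Bounded (λ x y → coef p q x y * X) (rank x + rank y) →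
                  Free a (clique x) V → Free b (clique y) V → card V ≤ coef p q x y * X
    prime-bound p q X none y bounded free-a free-b =
      let x , _ , x∈ , _ = proper in let z , z∈ = attached-a x x∈ in
      ⊥-elim (Outer-Free 0 V x (λ _ → id) x∈ free-a z z∈)
    prime-bound p q X tri none bounded free-a free-b =
      let x , _ , x∈ , _ = proper in let z , z∈ = attached-b x x∈ in
      ⊥-elim (Outer-Free 0 V x (λ _ → id) x∈ free-b z z∈)
    prime-bound p q X star none bounded free-a free-b =
      let x , _ , x∈ , _ = proper in let z , z∈ = attached-b x x∈ in
      ⊥-elim (Outer-Free 0 V x (λ _ → id) x∈ free-b z z∈)
    prime-bound p q X tri tri bounded free-a free-b =
      scale-* {coef p q none none} 5 X (check p q) (edgeless-bound 5 V (s≤s z≤n) bounded (λ _ → id) V-saturated (parts-free 1 1 free-a free-b)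
        (ramsey₂₂ (representatives V) (representatives-two V (λ _ → id)) (representatives-Free 2 V free-a) (representatives-Free 2 V free-b)))
      where
      check : ∀ p q → 5 * coef p q none none ≤ coef p q tri tri
      check = from-yes (all? λ p → all? λ q → 5 * coef p q none none ≤? coef p q tri tri)
    prime-bound p q X star tri bounded free-a free-b = ≤-trans
      (bound₃₂ V (λ _ → id) V-saturated (coef p q) (coef₃₂ p q) X (coef₃₂-bounds p q) bounded
        (λ x x∈ → map₂ (Free-suc 1 (Part x)) (parts-free 2 1 free-a free-b x x∈)) free-a free-b)
      (*-monoˡ-≤ X (check p q))
      where
      check : ∀ p q → coef₃₂ p q ≤ coef p q star tri
      check = from-yes (all? λ p → all? λ q → coef₃₂ p q ≤? coef p q star tri)
    prime-bound p q X tri star bounded free-a free-b = ≤-trans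
      (Flip.bound₃₂ V (λ _ → id) V-saturated (flip (coef p q)) (coef₃₂ p q) X (coef₃₂-bounds′ p q)
        (λ x y lt T T⊆V free-b free-a → bounded y x (subst (_< 3) (+-comm (rank x) (rank y)) lt) T T⊆V free-a free-b)
        (λ x x∈ → let part-a , part-b = parts-free 1 2 free-a free-b x x∈ in part-b , Free-suc 1 (Part x) part-a)
        free-b free-a)
      (*-monoˡ-≤ X (check p q))
      where
      check : ∀ p q → coef₃₂ p q ≤ coef p q tri star
      check = from-yes (all? λ p → all? λ q → coef₃₂ p q ≤? coef p q tri star)
    prime-bound p q X star star bounded free-a free-b with inner-edge? V
    ... | inj₂ edgeless = scale-* {coef p q none none} 17 X (check p q) (edgeless-bound 17 V (s≤s z≤n) bounded (λ _ → id) V-saturated edgeless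
            (ramsey₃₃ (representatives V) (representatives-two V (λ _ → id)) (representatives-Free 3 V free-a) (representatives-Free 3 V free-b)))
      where
      check : ∀ p q → 17 * coef p q none none ≤ coef p q star star
      check = from-yes (all? λ p → all? λ q → 17 * coef p q none none ≤? coef p q star star)
    ... | inj₁ (x , x∈ , edgy) with edge? a (Part x) | edge? b (Part x) | parts-free 2 2 free-a free-b
    ...   | inj₁ part-a | inj₁ part-b | _ = contradiction (part-a , part-b) edgy
    ...   | inj₂ (u , v , u∈ , v∈ , uv) | inj₂ (u′ , v′ , u′∈ , v′∈ , u′v′) | parts =
            ≤-trans (split V x (λ _ → id) x∈) (scale₃ {coef p q tri tri} {coef p q none star} {coef p q star none} X (check p q)
              (bounded tri tri (s≤s (s≤s (s≤s z≤n))) (Part x) (Part-⊆ x) (proj₁ (parts x x∈)) (proj₂ (parts x x∈)))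
              (bounded none star (s≤s (s≤s (s≤s z≤n))) (Outer a V x) (λ _ → proj₁)
                (Outer-Free₂ 1 V x (λ _ → id) x∈ (Part-⊆ x) u∈ v∈ uv free-a) (outer-free V a x 3 free-b))
              (bounded star none (s≤s (s≤s (s≤s z≤n))) (Outer b V x) (λ _ → proj₁)
                (outer-free V b x 3 free-a) (Outer-Free₂ 1 V x (λ _ → id) x∈ (Part-⊆ x) u′∈ v′∈ u′v′ free-b)))
      where
      check : ∀ p q → coef p q tri tri + (coef p q none star + coef p q star none) ≤ coef p q star star
      check = from-yes (all? λ p → all? λ q →
        coef p q tri tri + (coef p q none star + coef p q star none) ≤? coef p q star star)
    -- For `p` = `q` = 1 the sum is 20 + 34 + 74 = 128 ≤ 136. Bounding the second neighbourhood by
    -- the induction hypothesis would replace 74 by 85 and give 139.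
    ...   | inj₂ (u , v , u∈ , v∈ , uv) | inj₁ part-b | parts =
            ≤-trans (split V x (λ _ → id) x∈) (scale₃ {coef p q tri none} {coef p q none star} {coef₃₂ p q} X (check p q)
              (bounded tri none (s≤s (s≤s z≤n)) (Part x) (Part-⊆ x) (proj₁ (parts x x∈)) part-b)
              (bounded none star (s≤s (s≤s (s≤s z≤n))) (Outer a V x) (λ _ → proj₁)
                (Outer-Free₂ 1 V x (λ _ → id) x∈ (Part-⊆ x) u∈ v∈ uv free-a) (outer-free V a x 3 free-b))
              (bound₃₂ (Outer b V x) (λ _ → proj₁) (Outer-Saturated b x x∈) (coef p q) (coef₃₂ p q) X (coef₃₂-bounds p q)
                (λ y z lt → bounded y z (m<n⇒m<1+n lt)) parts
                (outer-free V b x 3 free-a) (Outer-Free 2 V x (λ _ → id) x∈ free-b)))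
      where
      check : ∀ p q → coef p q tri none + (coef p q none star + coef₃₂ p q) ≤ coef p q star star
      check = from-yes (all? λ p → all? λ q → coef p q tri none + (coef p q none star + coef₃₂ p q) ≤? coef p q star star)
    ...   | inj₁ part-a | inj₂ (u , v , u∈ , v∈ , uv) | parts =
            ≤-trans (split V x (λ _ → id) x∈) (scale₃ {coef p q none tri} {coef₃₂ p q} {coef p q star none} X (check p q)
              (bounded none tri (s≤s (s≤s z≤n)) (Part x) (Part-⊆ x) part-a (proj₂ (parts x x∈)))
              (Flip.bound₃₂ (Outer a V x) (λ _ → proj₁) (Outer-Saturated a x x∈) (flip (coef p q)) (coef₃₂ p q) X (coef₃₂-bounds′ p q)
                (λ y z lt T T⊆V free-b free-a →
                  bounded z y (m<n⇒m<1+n (subst (_< 3) (+-comm (rank y) (rank z)) lt)) T T⊆V free-a free-b)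
                (λ y y∈ → ×-swap (parts y y∈))
                (outer-free V a x 3 free-b) (Outer-Free 2 V x (λ _ → id) x∈ free-a))
              (bounded star none (s≤s (s≤s (s≤s z≤n))) (Outer b V x) (λ _ → proj₁)
                (outer-free V b x 3 free-a) (Outer-Free₂ 1 V x (λ _ → id) x∈ (Part-⊆ x) u∈ v∈ uv free-b)))
      where
      check : ∀ p q → coef p q none tri + (coef₃₂ p q + coef p q star none) ≤ coef p q star star
      check = from-yes (all? λ p → all? λ q → coef p q none tri + (coef₃₂ p q + coef p q star none) ≤? coef p q star star)

  -- The induction step, by contradiction

  module Step (s : Fin k → State) (V : Subset N) (avoids : ∀ d → Avoids (s d) d V)
              (ih : ∀ t T → sum (rank ∘ t) < sum (rank ∘ s) → (∀ d → Avoids (t d) d T) → card T ≤ weight t)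
              (large : weight s < card V) where

    -- A colour in state `star` makes the weight at least 4, which provides the fifth vertex that
    -- `connected⇒Free₃` asks for.
    large₁ : ∀ d → s d ≡ star → 5 ≤ card V
    large₁ d eq with weight₁ d s
    ... | p , q , X , 1≤X , weighs = ≤-trans (s≤s (≤-trans (*-mono-≤ (check p q) 1≤X) (≤-reflexive
            (sym (trans (weighs s (λ _ _ → refl)) (cong (λ x → coef p q x none * X) eq)))))) large
      where
      check : ∀ p q → 4 ≤ coef p q star none
      check = from-yes (all? λ p → all? λ q → 4 ≤? coef p q star none)

    connected⇒Free : ∀ d → Connected d V → Free d (clique (s d)) V
    connected⇒Free d connected with s d in eq | avoids d
    ... | none | free = free
    ... | tri  | free = free
    ... | star | free = connected⇒Free₃ d V connected (large₁ d eq) free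

    module Cut (d : Fin k) (A : Subset N) {x y : Fin N} (x∈V : x ∈ V) (x∈A : x ∈ A) (y∈V : y ∈ V) (y∉A : y ∉ A)
               (mono : ∀ u v → u ∈ V → u ∈ A → v ∈ V → v ∉ A → col c u v ≡ d) where

      mono′ : ∀ u v → u ∈ V → u ∈ A → v ∈ V → v ∉ A → col c v u ≡ d
      mono′ u v u∈V u∈A v∈V v∉A = trans (symm c v u) (mono u v u∈V u∈A v∈V v∉A)

      connected : Connected d V
      connected D p q p∈V p∈D q∈V q∉D with crossing? d V D
      ... | inj₁ crossing = crossing
      ... | inj₂ D-closed with p ∈? A | q ∈? A
      ...   | yes p∈A | no  q∉A = contradiction (mono p q p∈V p∈A q∈V q∉A) (D-closed p q p∈V p∈D q∈V q∉D)
      ...   | no  p∉A | yes q∈A = contradiction (mono′ q p q∈V q∈A p∈V p∉A) (D-closed p q p∈V p∈D q∈V q∉D)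
      -- Two vertices on the same side are linked through a vertex of the other side, `y` here and
      -- `x` below.
      ...   | yes p∈A | yes q∈A with y ∈? D
      ...     | yes y∈D = contradiction (mono′ q y q∈V q∈A y∈V y∉A) (D-closed y q y∈V y∈D q∈V q∉D)
      ...     | no  y∉D = contradiction (mono p y p∈V p∈A y∈V y∉A) (D-closed p y p∈V p∈D y∈V y∉D)
      connected D p q p∈V p∈D q∈V q∉D | inj₂ D-closed | no p∉A | no q∉A with x ∈? D
      ...     | yes x∈D = contradiction (mono x q x∈V x∈A q∈V q∉A) (D-closed x q x∈V x∈D q∈V q∉D)
      ...     | no  x∉D = contradiction (mono′ x p x∈V x∈A p∈V p∉A) (D-closed p x p∈V p∈D x∈V x∉D)

      left right : Subset N
      left = V ∩ A
      right = V ∩ ∁ A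

      sides : card V ≤ card left + card right
      sides = card-cover V left right λ u u∈V → case u ∈? A of λ
        { (yes u∈A) → inj₁ (u∈V , u∈A) ; (no u∉A) → inj₂ (u∈V , u∉A) }

      adjacent : ∀ {u v} → u ∈ left → v ∈ right → Adj d u v
      adjacent (u∈V , u∈A) (v∈V , v∉A) = (λ { refl → v∉A u∈A }) , mono _ _ u∈V u∈A v∈V v∉A

      left-free : ∀ r → Free d (suc r) V → Free d r left
      left-free r free = Free-⊆ r left (nbhd d V y)
        (λ u u∈ → proj₁ u∈ , adj-sym (adjacent u∈ (y∈V , y∉A))) (free y y∈V)

      right-free : ∀ r → Free d (suc r) V → Free d r right
      right-free r free = Free-⊆ r right (nbhd d V x)
        (λ v v∈ → proj₁ v∈ , adjacent (x∈V , x∈A) v∈) (free x x∈V)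

      -- Each side is joined completely to a vertex of the other in colour `d`, which lowers its
      -- clique bound by one. For `star` that alone gives `tri` on both sides, and one side must be
      -- lowered further.
      impossible : ⊥
      impossible with weight₁ d s
      ... | p , q , X , _ , weighs = <⇒≱ large (≤-trans (bound (s d) refl (connected⇒Free d connected))
                                       (≤-reflexive (sym (weighs s (λ _ _ → refl)))))
        where
        side-bound : ∀ z → rank z < rank (s d) → ∀ T → T ⊆ V → Free d (clique z) T → card T ≤ coef p q z none * X
        side-bound z lt T T⊆V free = ≤-trans
          (ih t T (sum-agree₁-< rank refl d s t agree (subst (λ z → rank z < rank (s d)) (sym t-d) lt)) t-avoids)
          (≤-reflexive (trans (weighs t agree) (cong (λ z → coef p q z none * X) t-d)))
          where
          t : Fin k → State
          t = assign d z s
          t-d : t d ≡ z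
          t-d = updateAt-updates d s
          agree : Agree₁ d s t
          agree e d≢e = updateAt-minimal e d s (d≢e ∘ sym)
          t-avoids : ∀ e → Avoids (t e) e T
          t-avoids e with d ≟ e
          ... | yes refl = subst (λ z → Avoids z d T) (sym t-d) (Free⇒Avoids z T free)
          ... | no  d≢e  = subst (λ z → Avoids z e T) (sym (agree e d≢e)) (Avoids-⊆ (s e) T V T⊆V (avoids e))
        bound : ∀ z → s d ≡ z → Free d (clique z) V → card V ≤ coef p q z none * X
        bound none eq free = ⊥-elim (left-free 0 free x (x∈V , x∈A))
        bound tri eq free = ≤-trans sides (scale₂ {coef p q none none} {coef p q none none} X (check p q)
          (side-bound none lt left (λ _ → proj₁) (left-free 1 free))
          (side-bound none lt right (λ _ → proj₁) (right-free 1 free)))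
          where
          lt : 0 < rank (s d)
          lt = subst (λ z → 0 < rank z) (sym eq) (s≤s z≤n)
          check : ∀ p q → coef p q none none + coef p q none none ≤ coef p q tri none
          check = from-yes (all? λ p → all? λ q → coef p q none none + coef p q none none ≤? coef p q tri none)
        bound star eq free with edge? d left
        ... | inj₁ edgeless = ≤-trans sides (scale₂ {coef p q none none} {coef p q tri none} X (check p q)
          (side-bound none (subst (λ z → 0 < rank z) (sym eq) (s≤s z≤n)) left (λ _ → proj₁) edgeless)
          (side-bound tri (subst (λ z → 1 < rank z) (sym eq) (s≤s (s≤s z≤n))) right (λ _ → proj₁) (right-free 2 free)))
          where
          check : ∀ p q → coef p q none none + coef p q tri none ≤ coef p q star none
          check = from-yes (all? λ p → all? λ q → coef p q none none + coef p q tri none ≤? coef p q star none)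
        -- An edge on the left together with an edge on the right would be a K₄, so the right side
        -- drops to `none`.
        ... | inj₂ (u , v , u∈ , v∈ , uv) = ≤-trans sides (scale₂ {coef p q tri none} {coef p q none none} X (check p q)
          (side-bound tri (subst (λ z → 1 < rank z) (sym eq) (s≤s (s≤s z≤n))) left (λ _ → proj₁) (left-free 2 free))
          (side-bound none (subst (λ z → 0 < rank z) (sym eq) (s≤s z≤n)) right (λ _ → proj₁)
            (Free-⊆ 1 right (nbhd d (nbhd d V u) v)
              (λ w w∈ → (proj₁ w∈ , adjacent u∈ w∈) , adjacent v∈ w∈)
              (free u (proj₁ u∈) v (proj₁ v∈ , uv)))))
          where
          check : ∀ p q → coef p q tri none + coef p q none none ≤ coef p q star none
          check = from-yes (all? λ p → all? λ q → coef p q tri none + coef p q none none ≤? coef p q star none)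

    module Prime {a b} (D : Decomposition V a b) where

      open Parts D

      other : ∀ x → ∃ λ y → y ∈ V × part x ≢ part y
      other x with proper
      ... | y , z , y∈ , z∈ , yz with part x ≟ part y
      ...   | yes xy = z , z∈ , subst (_≢ part z) (sym xy) yz
      ...   | no  xy = y , y∈ , xy

      -- Without such a neighbour, every edge leaving the part of `x` has colour `b`, which is a
      -- monochromatic cut.
      attached : Attached a
      attached x x∈ with any? (_∈? Outer a V x)
      ... | yes outer = outer
      ... | no  ∄ with other x
      ...   | y , y∈ , xy = ⊥-elim (Cut.impossible b (Part x) x∈ (self x∈) y∈ (xy ∘ sym ∘ proj₂) cross)
        where
        cross : ∀ u v → u ∈ V → u ∈ Part x → v ∈ V → v ∉ Part x → col c u v ≡ b
        cross u v u∈ (_ , ux) v∈ v∉P with part-two u∈ v∈ (λ uv → v∉P (v∈ , trans (sym uv) ux))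
        ... | inj₂ col-b = col-b
        ... | inj₁ col-a = contradiction (v , v∈ , xv , trans (same-col x∈ u∈ v∈ (sym ux) xv) col-a) ∄
          where
          xv : part x ≢ part v
          xv xv = v∉P (v∈ , sym xv)

      a≢b : a ≢ b
      a≢b refl = let x , y , x∈ , y∈ , xy = proper in
        Cut.impossible a (Part x) x∈ (self x∈) y∈ (xy ∘ sym ∘ proj₂) λ u v u∈ (_ , ux) v∈ v∉P →
          [ id , id ] (part-two u∈ v∈ (λ uv → v∉P (v∈ , trans (sym uv) ux)))

      -- A set `E` closed in colour `a` would yield a cut of colour `b`. The only doubtful edges are
      -- those inside a part.
      connected : Connected a V
      connected E d e d∈ d∈E e∈ e∉E with crossing? a V E
      ... | inj₁ crossing = crossing
      ... | inj₂ E-closed = ⊥-elim (Cut.impossible b E d∈ d∈E e∈ e∉E cross)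
        where
        cross : ∀ u v → u ∈ V → u ∈ E → v ∈ V → v ∉ E → col c u v ≡ b
        cross u v u∈ u∈E v∈ v∉E with part u ≟ part v
        ... | no  uv = [ (λ col-a → contradiction col-a (E-closed u v u∈ u∈E v∈ v∉E)) , id ] (part-two u∈ v∈ uv)
        -- An outer neighbour `y` of `u` in colour `a` is also one of `v`; on whichever side of `E`
        -- it lies, one of its two edges crosses in colour `a`.
        ... | yes uv with attached u u∈
        ...   | y , y∈ , uy , col-a with y ∈? E
        ...     | yes y∈E = contradiction (trans (symm c y v) (trans (sym (same-col u∈ v∈ y∈ uv uy)) col-a))
                              (E-closed y v y∈ y∈E v∈ v∉E)
        ...     | no  y∉E = contradiction col-a (E-closed u y u∈ u∈E y∈ y∉E)

    prime-impossible : ∀ {a b} → ¬ Decomposition V a b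
    prime-impossible {a} {b} D with weight₂ a b (Prime.a≢b D) s
    ... | p , q , X , _ , weighs = <⇒≱ large (≤-trans
            (prime-bound D (Prime.attached D) (Prime.attached (flipped D)) p q X (s a) (s b) bounded
              (connected⇒Free a (Prime.connected D)) (connected⇒Free b (Prime.connected (flipped D))))
            (≤-reflexive (sym (weighs s (λ _ _ _ → refl)))))
      where
      open Prime D using (a≢b)
      bounded : Parts.Bounded D (λ x y → coef p q x y * X) (rank (s a) + rank (s b))
      bounded x y lt T T⊆V free-a free-b = ≤-trans
        (ih t T (sum-agree₂-< rank refl a b a≢b s t agree
          (subst₂ (λ x y → rank x + rank y < rank (s a) + rank (s b)) (sym t-a) (sym t-b) lt)) t-avoids)
        (≤-reflexive (trans (weighs t agree) (cong₂ (λ x y → coef p q x y * X) t-a t-b)))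
        where
        t : Fin k → State
        t = assign b y (assign a x s)
        t-a : t a ≡ x
        t-a = trans (updateAt-minimal a b (assign a x s) a≢b) (updateAt-updates a s)
        t-b : t b ≡ y
        t-b = updateAt-updates b (assign a x s)
        agree : Agree₂ a b s t
        agree e a≢e b≢e = trans (updateAt-minimal e b (assign a x s) (b≢e ∘ sym)) (updateAt-minimal e a s (a≢e ∘ sym))
        t-avoids : ∀ e → Avoids (t e) e T
        t-avoids e with a ≟ e | b ≟ e
        ... | yes refl | _        = subst (λ z → Avoids z a T) (sym t-a) (Free⇒Avoids x T free-a)
        ... | no  _    | yes refl = subst (λ z → Avoids z b T) (sym t-b) (Free⇒Avoids y T free-b)
        ... | no  a≢e  | no  b≢e  = subst (λ z → Avoids z e T) (sym (agree e a≢e b≢e))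
                                      (Avoids-⊆ (s e) T V T⊆V (avoids e))

    impossible : ⊥
    impossible with inhabited V (≤-trans z<s large)
    -- The weight is at least 1, so `V` has a second vertex and can be decomposed.
    ... | x , x∈ with inhabited (V - x) (s≤s⁻¹ (begin
            2                          ≤⟨ s≤s (*-mono-≤ (starBound>0 (sum (#star ∘ s))) (triBound>0 (sum (#tri ∘ s)))) ⟩
            suc (weight s)             ≤⟨ large ⟩
            card V                     ≤⟨ card-cover V ⁅ x ⁆ (V - x) split-off ⟩
            card ⁅ x ⁆ + card (V - x)  ≡⟨ cong (_+ card (V - x)) (card-⁅⁆ x) ⟩
            1 + card (V - x)           ∎))
      where
      open ≤-Reasoning
      split-off : ∀ y → y ∈ V → y ∈ ⁅ x ⁆ ⊎ y ∈ (V - x)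
      split-off y y∈ with x ≟ y
      ... | yes x≡y = inj₁ x≡y
      ... | no  x≢y = inj₂ (y∈ , x≢y)
    ...   | y , y∈ , x≢y = let _ , _ , D = decompose (card V) V ≤-refl x∈ y∈ x≢y in prime-impossible D

  -- The induction is on the total rank; `V` stays arbitrary so that the hypothesis covers sides of
  -- cuts, parts and neighbourhoods.
  card≤weight : ∀ n s V → sum (rank ∘ s) < n → (∀ d → Avoids (s d) d V) → card V ≤ weight s
  card≤weight (suc n) s V lt avoids = ≮⇒≥ (Step.impossible s V avoids
    λ t T smaller → card≤weight n t T (≤-trans smaller (s≤s⁻¹ lt)))

weight-star : ∀ k → weight {k} (const star) ≡ starBound k
weight-star k = trans (cong₂ (λ m n → starBound m * triBound n) (card-full k) (sum-replicate-zero k)) (*-identityʳ _)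

-- A copy is sought exhaustively. If there is none, every colour is in state `star` on the full
-- vertex set, and the weight bounds `N`.
arrows : ∀ {k N} → starBound k < N → Arrows k N
arrows {k} {N} lt c gallai
  with any? (λ a → any? (λ x → any? (λ y → any? (λ z → any? (λ w → any? (λ t →
         (adj? a x y ×-dec adj? a x z ×-dec adj? a x w ×-dec adj? a y z ×-dec adj? a y w ×-dec adj? a z w) ×-dec
         adj? a x t ×-dec ¬? (y ≟ t) ×-dec ¬? (z ≟ t) ×-dec ¬? (w ≟ t)))))))
  where open Cliques c
... | yes (a , x , y , z , w , t , ((x≢y , xy) , (x≢z , xz) , (x≢w , xw) , (y≢z , yz) , (y≢w , yw) , (z≢w , zw)) ,
           (x≢t , xt) , y≢t , z≢t , w≢t) =
      lookup (x ∷ y ∷ z ∷ w ∷ t ∷ []) , a , (λ {i} {j} → lookup-injective unique i j) , xy , xz , xw , yz , yw , zw , xt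
  where
  unique = (x≢y ∷ x≢z ∷ x≢w ∷ x≢t ∷ []) ∷ (y≢z ∷ y≢w ∷ y≢t ∷ []) ∷ (z≢w ∷ z≢t ∷ []) ∷ (w≢t ∷ []) ∷ [] ∷ []
... | no ∄ = contradiction lt (≤⇒≯ (subst₂ _≤_ (card-full N) (weight-star k)
      (UpperBound.card≤weight c gallai _ (const star) (full N) ≤-refl
        λ a x y z w t (_ , (xy , xz , xw) , (yz , yw) , zw) _ xt y≢t z≢t w≢t →
          ∄ (a , x , y , z , w , t , (xy , xz , xw , yz , yw , zw) , xt , y≢t , z≢t , w≢t))))

-- The lower bound

Free? : ∀ {N k} (c : EdgeColoring N k) a r S → Dec (Cliques.Free c a r S)
Free? c a zero    S = all? λ x → ¬? (x ∈? S)
Free? c a (suc r) S = all? λ x → (x ∈? S) →-dec Free? c a r (Cliques.nbhd c a S x)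

K₄Free : ∀ {N k} → EdgeColoring N k → Set
K₄Free {N} c = ∀ a → Cliques.Free c a 3 (full N)

K₄Free⇒¬MonoK4e : ∀ {N k} {c : EdgeColoring N k} → K₄Free c → ¬ MonoK4e c
K₄Free⇒¬MonoK4e free (f , a , injective , e₀₁ , e₀₂ , e₀₃ , e₁₂ , e₁₃ , e₂₃ , _) =
  free a _ _ _ (_ , adj (λ ()) e₀₁) _ ((_ , adj (λ ()) e₀₂) , adj (λ ()) e₁₂)
    _ (((_ , adj (λ ()) e₀₃) , adj (λ ()) e₁₃) , adj (λ ()) e₂₃)
  where
  adj : ∀ {P : Set} {i j} → i ≢ j → P → f i ≢ f j × P
  adj i≢j e = i≢j ∘ injective , e

quadraticResidue? : (d : ℕ) → Dec (∃ λ (z : Fin 17) → (toℕ z * toℕ z) % 17 ≡ d)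
quadraticResidue? d = any? λ z → (toℕ z * toℕ z) % 17 ℕ.≟ d

-- Since -1 is a square modulo 17, the absolute difference may stand for the difference.
paley₁₇ : EdgeColoring 17 2
paley₁₇ .col x y = if does (quadraticResidue? ∣ toℕ x - toℕ y ∣) then zero else suc zero
paley₁₇ .symm x y rewrite ∣-∣-comm (toℕ x) (toℕ y) = refl

paley₁₇-K₄Free : K₄Free paley₁₇
paley₁₇-K₄Free = from-yes (all? λ a → Free? paley₁₇ a 3 (full 17))

two-colours⇒Gallai : ∀ {N} (c : EdgeColoring N 2) → Gallai c
two-colours⇒Gallai c (x , y , z , _ , _ , _ , xy≢yz , yz≢xz , xy≢xz) = pigeon _ _ _ xy≢yz yz≢xz xy≢xz
  where
  pigeon : (i j l : Fin 2) → i ≢ j → j ≢ l → i ≢ l → ⊥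
  pigeon zero       zero       l          i≢j _   _   = i≢j refl
  pigeon zero       (suc zero) zero       _   _   i≢l = i≢l refl
  pigeon zero       (suc zero) (suc zero) _   j≢l _   = j≢l refl
  pigeon (suc zero) zero       zero       _   j≢l _   = j≢l refl
  pigeon (suc zero) zero       (suc zero) _   _   i≢l = i≢l refl
  pigeon (suc zero) (suc zero) l          i≢j _   _   = i≢j refl

-- Blow-ups

module Blowup {q k₁ n k₂ : ℕ} (outer : EdgeColoring q k₁) (inner : EdgeColoring n k₂) where

  Q : Fin (q * n) → Fin q
  Q = quotient n

  R : Fin (q * n) → Fin n
  R = remainder {q} n

  QR-injective : ∀ {x y} → Q x ≡ Q y → R x ≡ R y → x ≡ y
  QR-injective {x} {y} qx≡qy rx≡ry =
    trans (sym (combine-remQuot {q} n x)) (trans (cong₂ combine qx≡qy rx≡ry) (combine-remQuot {q} n y))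

  blowup : EdgeColoring (q * n) (k₁ + k₂)
  blowup .col x y = if does (Q x ≟ Q y) then k₁ ↑ʳ col inner (R x) (R y) else col outer (Q x) (Q y) ↑ˡ k₂
  blowup .symm x y with Q x ≟ Q y | Q y ≟ Q x
  ... | yes _   | yes _   = cong (k₁ ↑ʳ_) (symm inner (R x) (R y))
  ... | no  _   | no  _   = cong (_↑ˡ k₂) (symm outer (Q x) (Q y))
  ... | yes x≡y | no  y≢x = contradiction (sym x≡y) y≢x
  ... | no  x≢y | yes y≡x = contradiction (sym y≡x) x≢y

  outer-edge : ∀ {x y i} → col blowup x y ≡ i ↑ˡ k₂ → Q x ≢ Q y × col outer (Q x) (Q y) ≡ i
  outer-edge {x} {y} {i} eq with Q x ≟ Q y
  ... | no neq = neq , ↑ˡ-injective k₂ _ _ eq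
  ... | yes _  = case trans (sym (splitAt-↑ʳ k₁ k₂ _)) (trans (cong (splitAt k₁) eq) (splitAt-↑ˡ k₁ i k₂)) of λ ()

  inner-edge : ∀ {x y i} → col blowup x y ≡ k₁ ↑ʳ i → Q x ≡ Q y × col inner (R x) (R y) ≡ i
  inner-edge {x} {y} {i} eq with Q x ≟ Q y
  ... | yes eq′ = eq′ , ↑ʳ-injective k₁ _ _ eq
  ... | no  _   = case trans (sym (splitAt-↑ʳ k₁ k₂ i)) (trans (cong (splitAt k₁) (sym eq)) (splitAt-↑ˡ k₁ _ k₂)) of λ ()

  -- If a triangle meets exactly two fibres, its two edges between them get the same outer colour.
  blowup-Gallai : Gallai outer → Gallai inner → Gallai blowup
  blowup-Gallai gallai₁ gallai₂ (x , y , z , x≢y , y≢z , x≢z , xy≢yz , yz≢xz , xy≢xz)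
    with Q x ≟ Q y | Q y ≟ Q z | Q x ≟ Q z
  ... | yes xy | yes yz | no  xz = xz (trans xy yz)
  ... | yes xy | no  yz | yes xz = yz (trans (sym xy) xz)
  ... | no  xy | yes yz | yes xz = xy (trans xz (sym yz))
  ... | yes xy | no  yz | no  xz = yz≢xz (cong (λ v → col outer v (Q z) ↑ˡ k₂) (sym xy))
  ... | no  xy | yes yz | no  xz = xy≢xz (cong (λ v → col outer (Q x) v ↑ˡ k₂) yz)
  ... | no  xy | no  yz | yes xz = xy≢yz (cong (_↑ˡ k₂) (trans (symm outer (Q x) (Q y)) (cong (col outer (Q y)) xz)))
  ... | yes xy | yes yz | yes xz = gallai₂ (R x , R y , R z ,
          x≢y ∘ QR-injective xy , y≢z ∘ QR-injective yz , x≢z ∘ QR-injective xz ,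
          xy≢yz ∘ cong (k₁ ↑ʳ_) , yz≢xz ∘ cong (k₁ ↑ʳ_) , xy≢xz ∘ cong (k₁ ↑ʳ_))
  ... | no  xy | no  yz | no  xz = gallai₁ (Q x , Q y , Q z , xy , yz , xz ,
          xy≢yz ∘ cong (_↑ˡ k₂) , yz≢xz ∘ cong (_↑ˡ k₂) , xy≢xz ∘ cong (_↑ˡ k₂))

  -- A K₄ in an outer colour has its vertices in distinct fibres and projects to a K₄ of `outer`;
  -- the pendant vertex may share a fibre with one of them, which is why `outer` has to avoid K₄
  -- itself. In an inner colour the copy is connected and stays within one fibre.
  blowup-¬MonoK4e : K₄Free outer → ¬ MonoK4e inner → ¬ MonoK4e blowup
  blowup-¬MonoK4e free ¬mono (f , a , injective , e₀₁ , e₀₂ , e₀₃ , e₁₂ , e₁₃ , e₂₃ , e₀₄)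
    with splitAt k₁ a in eq
  ... | inj₁ i with splitAt⁻¹-↑ˡ {k₁} {k₂} {a} eq
  ...   | refl = free i _ _ _ (_ , outer-edge e₀₁) _ ((_ , outer-edge e₀₂) , outer-edge e₁₂)
                   _ (((_ , outer-edge e₀₃) , outer-edge e₁₃) , outer-edge e₂₃)
  blowup-¬MonoK4e free ¬mono (f , a , injective , e₀₁ , e₀₂ , e₀₃ , e₁₂ , e₁₃ , e₂₃ , e₀₄)
      | inj₂ j with splitAt⁻¹-↑ʳ {k₁} {k₂} {a} eq
  ...   | refl = ¬mono (R ∘ f , j ,
            (λ {u} {v} eq → injective (QR-injective (trans (sym (one-fibre u)) (one-fibre v)) eq)) ,
            proj₂ (inner-edge e₀₁) , proj₂ (inner-edge e₀₂) , proj₂ (inner-edge e₀₃) , proj₂ (inner-edge e₁₂) ,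
            proj₂ (inner-edge e₁₃) , proj₂ (inner-edge e₂₃) , proj₂ (inner-edge e₀₄))
    where
    one-fibre : ∀ v → Q (f zero) ≡ Q (f v)
    one-fibre zero                         = refl
    one-fibre (suc zero)                   = proj₁ (inner-edge e₀₁)
    one-fibre (suc (suc zero))             = proj₁ (inner-edge e₀₂)
    one-fibre (suc (suc (suc zero)))       = proj₁ (inner-edge e₀₃)
    one-fibre (suc (suc (suc (suc zero)))) = proj₁ (inner-edge e₀₄)

extremal : ∀ k → 1 ≤ k → Σ (EdgeColoring (starBound k) k) λ c → Gallai c × ¬ MonoK4e c
-- Four vertices in a single colour form a K₄ but leave no room for the pendant vertex.
extremal 1 _ = record { col = λ _ _ → zero ; symm = λ _ _ → refl }
  , (λ (_ , _ , _ , _ , _ , _ , xy≢yz , _) → xy≢yz refl)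
  , λ (_ , _ , injective , _) → contradiction (injective⇒≤ injective) (from-no (5 ≤? 4))
extremal 2 _ = paley₁₇ , two-colours⇒Gallai paley₁₇ , K₄Free⇒¬MonoK4e {c = paley₁₇} paley₁₇-K₄Free
extremal (suc (suc (suc k))) _ =
  let c , gallai , ¬mono = extremal (suc k) (s≤s z≤n)
      open Blowup paley₁₇ c
  in blowup , blowup-Gallai (two-colours⇒Gallai paley₁₇) gallai , blowup-¬MonoK4e paley₁₇-K₄Free ¬mono

-- Colourings restrict to fewer vertices, so one extremal colouring rules out all smaller `M` as
-- well.
Arrows-mono : ∀ {k M N} → M ≤ N → Arrows k M → Arrows k N
Arrows-mono {k} {M} {N} M≤N arrows c gallai =
  let f , a , injective , edges = arrows restricted restricted-Gallai
  in ι ∘ f , a , injective ∘ ι-injective , edges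
  where
  ι : Fin M → Fin N
  ι x = inject≤ x M≤N
  ι-injective : ∀ {x y} → ι x ≡ ι y → x ≡ y
  ι-injective = inject≤-injective M≤N M≤N _ _
  restricted : EdgeColoring M k
  restricted = record { col = λ x y → col c (ι x) (ι y) ; symm = λ x y → symm c (ι x) (ι y) }
  restricted-Gallai : Gallai restricted
  restricted-Gallai (x , y , z , x≢y , y≢z , x≢z , distinct) =
    gallai (ι x , ι y , ι z , x≢y ∘ ι-injective , y≢z ∘ ι-injective , x≢z ∘ ι-injective , distinct)

gallai-ramsey : ∀ k → 1 ≤ k → IsGR-K4e k (starBound k + 1)
gallai-ramsey k 1≤k = arrows (≤-reflexive (+-comm 1 (starBound k))) , λ M M< arrowsM →
  let c , gallai , ¬mono = extremal k 1≤k
  in ¬mono (Arrows-mono (s≤s⁻¹ (subst (M <_) (+-comm (starBound k) 1) M<)) arrowsM c gallai)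

theorem1p7 : ∀ (k : ℕ) → 1 ≤ k →
    (∀ (m : ℕ) → k ≡ 2 * m → IsGR-K4e k (17 ^ m + 1)) ×
    (∀ (m : ℕ) → k ≡ 2 * m + 1 → IsGR-K4e k (4 * 17 ^ m + 1))
theorem1p7 k 1≤k =
  (λ m k≡2m → subst (λ N → IsGR-K4e k (N + 1)) (even m k≡2m) (gallai-ramsey k 1≤k)) ,
  (λ m k≡2m+1 → subst (λ N → IsGR-K4e k (N + 1)) (odd m k≡2m+1) (gallai-ramsey k 1≤k))
  where
  even : ∀ m → k ≡ 2 * m → starBound k ≡ 17 ^ m
  even m refl = trans (cong starBound (trans (*-comm 2 m) (sym (+-identityʳ (m * 2)))))
                      (trans (starBound-+ m 0) (*-identityˡ (17 ^ m)))
  odd : ∀ m → k ≡ 2 * m + 1 → starBound k ≡ 4 * 17 ^ m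
  odd m refl = trans (cong (λ n → starBound (n + 1)) (*-comm 2 m)) (starBound-+ m 1)
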